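{- For a strongly connected digraph $D$ on $n$ vertices, the problem $k$-DMLOB can be solved in time $2^{O(k\log^2 k)}\cdot n^{O(1)}$. That is, there exist an algorithm and an absolute constant $c$ such that, given any strongly connected digraph $D$ on $n$ vertices and any positive integer $k$, the algorithm correctly decides whether $D$ has an out-branching with at least $k$ leaves, in time at most $c\cdot 2^{c k\log^2 k}\cdot n^{c}$.
   Context: Digraphs are finite, with no loops and no parallel arcs (directed 2-cycles are allowed). A digraph is strongly connected if for every pair $x,y$ of vertices there are directed paths from $x$ to $y$ and from $y$ to $x$. A subdigraph $T$ of a digraph $D$ is an out-tree if $T$ is an oriented tree with only one vertex of in-degree zero (called the root); if moreover $V(T)=V(D)$, then $T$ is called an out-branching of $D$. The leaves of $T$ are its vertices of out-degree zero in $T$. The problem $k$-DMLOB (parameterized Directed Maximum Leaf Out-Branching) is: given a digraph $D$ and a positive integral parameter $k$, decide whether $D$ has an out-branching with at least $k$ leaves. -}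

module Defs where

open import Data.Bool using (Bool; true; false; T; _∧_)
open import Data.Fin using (Fin)
open import Data.Fin.Subset using (Subset; _∈_; ∣_∣)
open import Data.List as List using (List; []; _∷_; length)
open import Data.List.Relation.Unary.Unique.Propositional using (Unique)
open import Data.Nat using (ℕ; suc; _+_; _≤_; _≥_; _≡ᵇ_; NonZero)
open import Data.Product using (Σ-syntax; ∃!; _×_; _,_)
open import Data.Sum using (_⊎_)
open import Data.Vec as Vec using (Vec; []; _∷_; lookup)
open import Relation.Binary.Construct.Closure.ReflexiveTransitive
  using (Star; ε; _◅_)
open import Relation.Binary.PropositionalEquality using (_≡_; refl)
open import Relation.Nullary using (¬_)

------------------------------------------------------------------------
-- Paths and cycles

module _ {A : Set} {R : A → A → Set} where

  vertices : ∀ {x y} → Star R x y → List A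
  vertices {x} ε       = x ∷ []
  vertices {x} (_ ◅ w) = x ∷ vertices w

record Path {A : Set} (R : A → A → Set) (x y : A) : Set where
  field
    walk   : Star R x y
    simple : Unique (vertices walk)

-- For a symmetric R: a path on at least three vertices whose ends are
-- adjacent.
record Cycle {A : Set} (R : A → A → Set) : Set where
  field
    {start end} : A
    path        : Path R start end
    long        : length (vertices (Path.walk path)) ≥ 3
    closing     : R end start

------------------------------------------------------------------------
-- Digraphs

-- Arcs form a set of ordered pairs, so parallel arcs cannot occur; arcs
-- x → y and y → x may both be present.  The vertex set is nonempty, as
-- usual.
record Digraph : Set where
  field
    order     : ℕ
    nonEmpty  : NonZero order
    arc       : Fin order → Fin order → Bool
    loopless  : ∀ x → ¬ T (arc x x)

  Arc : Fin order → Fin order → Set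
  Arc x y = T (arc x y)

open Digraph public using (order)

StronglyConnected : Digraph → Set
StronglyConnected D = ∀ x y → Path Arc x y × Path Arc y x
  where open Digraph D

record Subdigraph (D : Digraph) : Set where
  open Digraph D using () renaming (Arc to ArcD)
  field
    V   : Subset (order D)
    arc : Fin (order D) → Fin (order D) → Bool

  Arc : Fin (order D) → Fin (order D) → Set
  Arc x y = T (arc x y)

  field
    arc⊆   : ∀ {x y} → Arc x y → ArcD x y
    tail∈V : ∀ {x y} → Arc x y → x ∈ V
    head∈V : ∀ {x y} → Arc x y → y ∈ V

  -- Adjacency in the underlying undirected graph.
  Edge : Fin (order D) → Fin (order D) → Set
  Edge x y = Arc x y ⊎ Arc y x

  inDegree outDegree : Fin (order D) → ℕ
  inDegree  y = ∣ Vec.tabulate (λ x → arc x y) ∣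
  outDegree x = ∣ Vec.tabulate (λ y → arc x y) ∣

  leaves : Subset (order D)
  leaves = Vec.tabulate (λ x → lookup V x ∧ (outDegree x ≡ᵇ 0))

module _ {D : Digraph} (S : Subdigraph D) where
  open Subdigraph S

  -- An orientation of a tree.  Nonemptiness is not demanded here; it
  -- follows from the existence of a root in IsOutTree.
  record IsOrientedTree : Set where
    field
      oriented  : ∀ {x y} → Arc x y → ¬ Arc y x
      connected : ∀ {x y} → x ∈ V → y ∈ V → Path Edge x y
      acyclic   : ¬ Cycle Edge

  record IsOutTree : Set where
    field
      isOrientedTree : IsOrientedTree
      uniqueRoot     : ∃! _≡_ (λ r → r ∈ V × inDegree r ≡ 0)

  record IsOutBranching : Set where
    field
      isOutTree : IsOutTree
      spanning  : ∀ x → x ∈ V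

HasOutBranchingWithLeaves : Digraph → ℕ → Set
HasOutBranchingWithLeaves D k =
  Σ[ B ∈ Subdigraph D ] IsOutBranching B × k ≤ ∣ Subdigraph.leaves B ∣

------------------------------------------------------------------------
-- Model of computation
--
-- Algorithms are closed programs of a first-order functional language
-- whose only data are binary trees (as in N. D. Jones, "Computability
-- and Complexity from a Programming Perspective").  A program is a finite
-- table of mutually recursive functions together with a main expression.
-- Evaluation is call-by-value, and its cost is the number of expression
-- occurrences evaluated.  With trees represented by pointers, every unit
-- of cost is a bounded amount of work (the bound depending only on the
-- program) for a random access or pointer machine, and the model is
-- polynomially equivalent to Turing machines.

data Value : Set where
  nil  : Value
  cons : Value → Value → Value

-- Exp arity n: expressions with n variables in scope (de Bruijn indices),
-- where function f takes arity f arguments.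
data Exp {m : ℕ} (arity : Fin m → ℕ) (n : ℕ) : Set where
  var   : Fin n → Exp arity n
  nil   : Exp arity n
  cons  : Exp arity n → Exp arity n → Exp arity n
  case  : Exp arity n → Exp arity n → Exp arity (2 + n) → Exp arity n
  let′  : Exp arity n → Exp arity (suc n) → Exp arity n
  call  : (f : Fin m) → Vec (Exp arity n) (arity f) → Exp arity n

record Program (inputs : ℕ) : Set where
  field
    functions : ℕ
    arity     : Fin functions → ℕ
    body      : (f : Fin functions) → Exp arity (arity f)
    main      : Exp arity inputs

module _ {i : ℕ} (P : Program i) where
  open Program P

  mutual

    -- Eval ρ e v t: in environment ρ, e evaluates to v at cost t.
    data Eval {n} (ρ : Vec Value n) : Exp arity n → Value → ℕ → Set where

      var : ∀ x → Eval ρ (var x) (lookup ρ x) 1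

      nil : Eval ρ nil nil 1

      cons : ∀ {e₁ e₂ v₁ v₂ t₁ t₂} →
             Eval ρ e₁ v₁ t₁ → Eval ρ e₂ v₂ t₂ →
             Eval ρ (cons e₁ e₂) (cons v₁ v₂) (suc (t₁ + t₂))

      case-nil : ∀ {e e₁ e₂ v t t₁} →
                 Eval ρ e nil t → Eval ρ e₁ v t₁ →
                 Eval ρ (case e e₁ e₂) v (suc (t + t₁))

      case-cons : ∀ {e e₁ e₂ v₁ v₂ v t t₂} →
                  Eval ρ e (cons v₁ v₂) t → Eval (v₁ ∷ v₂ ∷ ρ) e₂ v t₂ →
                  Eval ρ (case e e₁ e₂) v (suc (t + t₂))

      let′ : ∀ {e₁ e₂ v₁ v t₁ t₂} →
             Eval ρ e₁ v₁ t₁ → Eval (v₁ ∷ ρ) e₂ v t₂ →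
             Eval ρ (let′ e₁ e₂) v (suc (t₁ + t₂))

      call : ∀ {f es vs v t₁ t₂} →
             EvalArgs ρ es vs t₁ → Eval vs (body f) v t₂ →
             Eval ρ (call f es) v (suc (t₁ + t₂))

    data EvalArgs {n} (ρ : Vec Value n) :
         ∀ {a} → Vec (Exp arity n) a → Vec Value a → ℕ → Set where

      []  : EvalArgs ρ [] [] 0

      _∷_ : ∀ {a e v t₁ t₂} {es : Vec (Exp arity n) a} {vs : Vec Value a} →
            Eval ρ e v t₁ → EvalArgs ρ es vs t₂ →
            EvalArgs ρ (e ∷ es) (v ∷ vs) (t₁ + t₂)

  -- Both result and cost are determined by the expression and environment.
  mutual

    Eval-deterministic :
      ∀ {n} {ρ : Vec Value n} {e v w s t} →
      Eval ρ e v s → Eval ρ e w t → v ≡ w × s ≡ t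
    Eval-deterministic (var x) (var .x) = refl , refl
    Eval-deterministic nil nil = refl , refl
    Eval-deterministic (cons a b) (cons c d)
      with refl , refl ← Eval-deterministic a c
         | refl , refl ← Eval-deterministic b d = refl , refl
    Eval-deterministic (case-nil a b) (case-nil c d)
      with refl , refl ← Eval-deterministic a c
      with refl , refl ← Eval-deterministic b d = refl , refl
    Eval-deterministic (case-nil a b) (case-cons c d)
      with () , _ ← Eval-deterministic a c
    Eval-deterministic (case-cons a b) (case-nil c d)
      with () , _ ← Eval-deterministic a c
    Eval-deterministic (case-cons a b) (case-cons c d)
      with refl , refl ← Eval-deterministic a c
      with refl , refl ← Eval-deterministic b d = refl , refl
    Eval-deterministic (let′ a b) (let′ c d)
      with refl , refl ← Eval-deterministic a c
      with refl , refl ← Eval-deterministic b d = refl , refl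
    Eval-deterministic (call a b) (call c d)
      with refl , refl ← EvalArgs-deterministic a c
      with refl , refl ← Eval-deterministic b d = refl , refl

    EvalArgs-deterministic :
      ∀ {n a} {ρ : Vec Value n} {es : Vec (Exp arity n) a} {vs ws s t} →
      EvalArgs ρ es vs s → EvalArgs ρ es ws t → vs ≡ ws × s ≡ t
    EvalArgs-deterministic [] [] = refl , refl
    EvalArgs-deterministic (a ∷ b) (c ∷ d)
      with refl , refl ← Eval-deterministic a c
         | refl , refl ← EvalArgs-deterministic b d = refl , refl

Run : ∀ {i} → Program i → Vec Value i → Value → ℕ → Set
Run P inputs = Eval P inputs (Program.main P)

------------------------------------------------------------------------
-- Encoding of inputs and outputs

encodeList : List Value → Value
encodeList = List.foldr cons nil

encodeBool : Bool → Value
encodeBool false = nil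
encodeBool true  = cons nil nil

-- Unary; computing this from the binary expansion of k takes time
-- polynomial in k.
encodeℕ : ℕ → Value
encodeℕ k = encodeList (List.replicate k nil)

-- The adjacency matrix, row by row.
encodeDigraph : Digraph → Value
encodeDigraph D =
  encodeList (List.tabulate λ x →
  encodeList (List.tabulate λ y → encodeBool (Digraph.arc D x y)))

{-# OPTIONS --safe #-}

-- Fix a root r.  Growing an out-tree amounts to growing its set S of inner vertices, connected from r: its
-- leaves are the vertices covered by S (r itself and the out-neighbours of S) that lie outside S.  In a
-- strongly connected digraph such an S with k leaves can be enlarged until everything is covered without
-- losing leaves, so an out-branching with k leaves exists iff for some r there is an S with at least k leaves.
--
-- The search is the branching of Kneis, Langer and Rossmanith.  Leaves are red (they stay leaves) or blue.
-- Pick a blue leaf u and first colour it red.  If this fails, make u inner, so that its uncovered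
-- out-neighbours become blue.  If there are none, u could have been red.  If there is just one, w, and w
-- stays a leaf, then u could again have been red, so w must be inner too: continue with w without
-- branching.  Otherwise the number d of missing leaves drops.  Hence (number of blue leaves) + 2d decreases
-- in both branches, and the search tree has at most 2^(2k) nodes up to a constant factor.  For k ≥ 2 this is
-- within 2^O(k log² k); for k = 1 it is a constant.
module Submission where

open import Defs
open import Data.Bool using (Bool; T)
open import Data.Nat using (ℕ; _*_; _^_; _≤_; _≥_)
open import Data.Nat.Logarithm using (⌊log₂_⌋)
open import Data.Product using (Σ-syntax; _×_)
open import Data.Vec using ([]; _∷_)
open import Function.Bundles using (_⇔_)

open import Data.Bool using (true; false; _∧_; _∨_; not; if_then_else_)
open import Data.Bool.Properties using (T-∨; T-∧; T-≡)
open import Data.Fin as Fin using (Fin; #_; zero; suc)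
open import Data.Fin.Properties using (_≟_; suc-injective)
open import Data.Fin.Subset using (Subset; ∣_∣; inside; outside; ⊤)
import Data.Fin.Subset as Subset
import Data.Fin.Subset.Properties as Subset
open import Data.List as List
  using (List; []; _∷_; _++_; length; map; filter; allFin; replicate; tabulate)
open import Data.List.Membership.Propositional using (_∈_; _∉_)
open import Data.List.Membership.Propositional.Properties
open import Data.List.Properties
  using (++-assoc; length-++; length-map; length-tabulate; map-++; map-tabulate; tabulate-cong)
open import Data.List.Relation.Binary.Permutation.Propositional
  using (_↭_; ↭-sym; ↭-trans; ↭-reflexive; ↭⇒↭ₛ)
open import Data.List.Relation.Binary.Permutation.Propositional.Properties
  using (shift; ∈-resp-↭; ↭-length; ++⁺ˡ)
import Data.List.Relation.Binary.Permutation.Setoid.Properties as PermSetoid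
open import Data.List.Relation.Binary.Subset.Propositional using (_⊆_)
open import Data.List.Relation.Unary.All as All using (All; []; _∷_)
import Data.List.Relation.Unary.All.Properties as All
open import Data.List.Relation.Unary.AllPairs using ([]; _∷_)
open import Data.List.Relation.Unary.Any using (here; there)
open import Data.List.Relation.Unary.Unique.Propositional using (Unique)
import Data.List.Relation.Unary.Unique.Propositional.Properties as Unique
open import Data.Nat using (zero; suc; _+_; _∸_; _<_; z≤n; s≤s)
open import Data.Nat.Induction using (<-wellFounded)
open import Data.Nat.Logarithm using (⌊log₂⌋-mono-≤)
open import Data.Nat.Properties hiding (_≟_; suc-injective)
open import Data.Nat.Tactic.RingSolver using (solve-∀)
open import Data.Product using (∃; _,_; proj₁; proj₂)
open import Data.Sum using (_⊎_; inj₁; inj₂; [_,_]′; swap)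
open import Data.Vec as Vec using (Vec; lookup)
open import Data.Vec.Properties using (lookup∘tabulate; lookup⇒[]=; []=⇒lookup; lookup-replicate)
open import Function using (_∘_; id; mk⇔; Equivalence)
open import Induction.WellFounded using (Acc; acc)
open import Relation.Binary using (DecidableEquality)
open import Relation.Binary.Construct.Closure.ReflexiveTransitive as Star
  using (Star; ε; _◅_; _◅◅_)
open import Relation.Binary.PropositionalEquality
open import Relation.Nullary
open import Relation.Nullary.Decidable
  using (⌊_⌋; decidable-stable; toWitness; fromWitness; _×-dec_; ¬?)
open Equivalence using (to; from)

-- The program

-- Next to a binder stand the variables in scope, innermost first.  A vertex is represented by its row of the
-- adjacency matrix, and a set of vertices by a list of rows (B, R, new).  M is the matrix with the rows of
-- covered vertices replaced by nil; d is the number of leaves still missing, and P the characteristic vector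
-- of the root, cut off after the entry of the root.

pattern select = zero
pattern remove = suc zero
pattern append = suc (suc zero)
pattern minus  = suc (suc (suc zero))
pattern search = suc (suc (suc (suc zero)))
pattern expand = suc (suc (suc (suc (suc zero))))
pattern roots  = suc (suc (suc (suc (suc (suc zero)))))

arity : Fin 7 → ℕ
arity select = 2
arity remove = 2
arity append = 2
arity minus  = 2
arity search = 3
arity expand = 4
arity roots  = 4

v : ∀ {n} (x : ℕ) {x<n : True (x Data.Nat.<? n)} → Exp arity n
v x {x<n} = var (#_ x {m<n = x<n})

yes′ : ∀ {n} → Exp arity n
yes′ = cons nil nil

body : (f : Fin 7) → Exp arity (arity f)
body select =                                            -- M u
  case (v 0) nil                                         -- row M′ M u
    (case (v 3) nil                                      -- bit u′ row M′ M u
      -- An unset bit means no arc to this vertex; a `nil` row means that the vertex is covered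
      -- already.
      (case (v 0) (call select (v 3 ∷ v 1 ∷ []))
        (case (v 4) (call select (v 5 ∷ v 3 ∷ []))
          (cons (v 6) (call select (v 7 ∷ v 5 ∷ []))))))
body remove =                                            -- M u
  case (v 0) nil                                         -- row M′ M u
    (case (v 3) (v 2)                                    -- bit u′ row M′ M u
      (cons (case (v 0) (v 2) nil) (call remove (v 3 ∷ v 1 ∷ []))))
body append =
  case (v 0) (v 1) (cons (v 0) (call append (v 1 ∷ v 3 ∷ [])))
body minus =
  case (v 0) nil (case (v 3) (v 2) (call minus (v 3 ∷ v 1 ∷ [])))
body search =                                            -- M B d
  case (v 2) yes′                                        -- _ _ M B d
    (case (v 3) nil                                      -- u B′ _ _ M B d
      -- Red leaves are not stored: `d` already counts `u` as present, so colouring it red only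
      -- drops it from `B`.
      (case (call search (v 4 ∷ v 1 ∷ v 6 ∷ []))
        (call expand (v 4 ∷ v 0 ∷ v 1 ∷ v 6 ∷ []))
        yes′))
body expand =                                            -- M u B d
  let′ (call select (v 0 ∷ v 1 ∷ []))                    -- new M u B d
    (case (v 0) nil                                      -- w rest new M u B d
      (case (v 1)
        (call expand (call remove (v 3 ∷ v 4 ∷ []) ∷ v 0 ∷ v 5 ∷ v 6 ∷ []))
                                                         -- _ _ w rest new M u B d
        (call search (call remove (v 5 ∷ v 6 ∷ []) ∷
                      call append (v 4 ∷ v 7 ∷ []) ∷
                      call minus (v 8 ∷ v 3 ∷ []) ∷ []))))
body roots =                                             -- M R P d
  case (v 1) nil                                         -- u R′ M R P d
    (case (call search (call remove (v 2 ∷ v 4 ∷ []) ∷ cons (v 0) nil ∷ v 5 ∷ []))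
      (call roots (v 2 ∷ v 1 ∷ cons nil (v 4) ∷ v 5 ∷ []))
      yes′)

program : Program 2
program = record
  { functions = 7
  ; arity     = arity
  ; body      = body
  ; main      =                                          -- M k
      case (v 1) yes′                                    -- _ k′ M k
        -- Every row is tried as root, starting with the first, which `cons yes′ nil` marks. The
        -- root alone is already one leaf, so `k′`, the predecessor of `k`, leaves are missing.
        (call roots (v 2 ∷ v 2 ∷ cons yes′ nil ∷ v 1 ∷ []))
  }

-- Evaluation within a cost bound

infix 4 _⊢_⇓_within_ _⊢*_⇓_within_

-- Upper bounds instead of exact costs let branches of different cost share one bound. The
-- combinators below assemble the bound by unification, so a run is a term that follows the program
-- text.
record _⊢_⇓_within_ {n} (ρ : Vec Value n) (e : Exp arity n) (w : Value) (b : ℕ) : Set where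
  constructor within
  field
    {cost}  : ℕ
    eval    : Eval program ρ e w cost
    bounded : cost ≤ b

record _⊢*_⇓_within_ {n a} (ρ : Vec Value n) (es : Vec (Exp arity n) a) (ws : Vec Value a)
                     (b : ℕ) : Set where
  constructor within
  field
    {cost}  : ℕ
    eval    : EvalArgs program ρ es ws cost
    bounded : cost ≤ b

module _ {n} {ρ : Vec Value n} where

  ⇓var : ∀ {x} → ρ ⊢ var x ⇓ lookup ρ x within 1
  ⇓var = within (var _) ≤-refl

  ⇓nil : ρ ⊢ nil ⇓ nil within 1
  ⇓nil = within nil ≤-refl

  ⇓cons : ∀ {e₁ e₂ w₁ w₂ b₁ b₂} → ρ ⊢ e₁ ⇓ w₁ within b₁ → ρ ⊢ e₂ ⇓ w₂ within b₂ →
          ρ ⊢ cons e₁ e₂ ⇓ cons w₁ w₂ within suc (b₁ + b₂)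
  ⇓cons (within x p) (within y q) = within (cons x y) (s≤s (+-mono-≤ p q))

  ⇓case-nil : ∀ {e e₁ e₂ w b b₁} → ρ ⊢ e ⇓ nil within b → ρ ⊢ e₁ ⇓ w within b₁ →
              ρ ⊢ case e e₁ e₂ ⇓ w within suc (b + b₁)
  ⇓case-nil (within x p) (within y q) = within (case-nil x y) (s≤s (+-mono-≤ p q))

  ⇓case-cons : ∀ {e e₁ e₂ w₁ w₂ w b b₂} → ρ ⊢ e ⇓ cons w₁ w₂ within b →
               (w₁ ∷ w₂ ∷ ρ) ⊢ e₂ ⇓ w within b₂ → ρ ⊢ case e e₁ e₂ ⇓ w within suc (b + b₂)
  ⇓case-cons (within x p) (within y q) = within (case-cons x y) (s≤s (+-mono-≤ p q))

  ⇓let : ∀ {e₁ e₂ w₁ w b₁ b₂} → ρ ⊢ e₁ ⇓ w₁ within b₁ → (w₁ ∷ ρ) ⊢ e₂ ⇓ w within b₂ →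
         ρ ⊢ let′ e₁ e₂ ⇓ w within suc (b₁ + b₂)
  ⇓let (within x p) (within y q) = within (let′ x y) (s≤s (+-mono-≤ p q))

  ⇓call : ∀ {f es ws w b₁ b₂} → ρ ⊢* es ⇓ ws within b₁ → ws ⊢ body f ⇓ w within b₂ →
          ρ ⊢ call f es ⇓ w within suc (b₁ + b₂)
  ⇓call (within x p) (within y q) = within (call x y) (s≤s (+-mono-≤ p q))

  ⇓[] : ρ ⊢* [] ⇓ [] within 0
  ⇓[] = within [] z≤n

  infixr 5 _⇓∷_
  _⇓∷_ : ∀ {a e w b₁ b₂} {es : Vec (Exp arity n) a} {ws} →
         ρ ⊢ e ⇓ w within b₁ → ρ ⊢* es ⇓ ws within b₂ → ρ ⊢* e ∷ es ⇓ w ∷ ws within (b₁ + b₂)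
  within x p ⇓∷ within y q = within (x ∷ y) (+-mono-≤ p q)

  ⇓weaken : ∀ {e w b b′} → b ≤ b′ → ρ ⊢ e ⇓ w within b → ρ ⊢ e ⇓ w within b′
  ⇓weaken le (within x p) = within x (≤-trans p le)

  ⇓result : ∀ {e w w′ b} → w ≡ w′ → ρ ⊢ e ⇓ w within b → ρ ⊢ e ⇓ w′ within b
  ⇓result refl run = run

  ⇓yes : ρ ⊢ yes′ ⇓ encodeBool true within 3
  ⇓yes = ⇓cons ⇓nil ⇓nil

-- Correctness and cost of the list functions

bits : List Bool → Value
bits = encodeList ∘ map encodeBool

-- `p` will be the row of the vertex being expanded and `c` the covered set. A covered vertex is
-- recognised by its `nil` entry, so `h` must never yield `nil`. The costliest branch takes 13 units
-- per entry; the others are padded.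
⇓select : ∀ {A : Set} (p c : A → Bool) (h : A → Value) → (∀ x → ∃ λ a → ∃ λ b → h x ≡ cons a b) →
  ∀ xs →
  encodeList (map (λ x → if c x then nil else h x) xs) ∷ bits (map p xs) ∷ []
    ⊢ body select ⇓ encodeList (map h (filter (λ x → T? (p x ∧ not (c x))) xs))
    within length xs * 13 + 3
⇓select p c h h-cons [] = ⇓case-nil ⇓var ⇓nil
⇓select p c h h-cons (x ∷ xs) with ⇓select p c h h-cons xs | p x | c x | h x in eq | h-cons x
... | ih | false | _ | _ | _ =
  ⇓case-cons ⇓var (⇓case-cons ⇓var
    (⇓weaken (m≤n+m _ 4) (⇓case-nil ⇓var (⇓call (⇓var ⇓∷ ⇓var ⇓∷ ⇓[]) ih))))
... | ih | true | true | _ | _ =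
  ⇓case-cons ⇓var (⇓case-cons ⇓var (⇓case-cons ⇓var
    (⇓weaken (m≤n+m _ 2) (⇓case-nil ⇓var (⇓call (⇓var ⇓∷ ⇓var ⇓∷ ⇓[]) ih)))))
... | ih | true | false | _ | _ , _ , refl rewrite eq =
  ⇓case-cons ⇓var (⇓case-cons ⇓var (⇓case-cons ⇓var (⇓case-cons ⇓var
    (⇓cons ⇓var (⇓call (⇓var ⇓∷ ⇓var ⇓∷ ⇓[]) ih)))))

-- A bit list that ends early leaves the remaining entries alone; this is why the vector of the root
-- may be cut off.
erase : List Value → List Bool → List Value
erase []       bs       = []
erase (w ∷ ws) []       = w ∷ ws
erase (w ∷ ws) (b ∷ bs) = (if b then nil else w) ∷ erase ws bs

⇓remove : ∀ ws bs →
  encodeList ws ∷ bits bs ∷ [] ⊢ body remove ⇓ encodeList (erase ws bs) within length ws * 13 + 3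
⇓remove []       bs       = ⇓case-nil ⇓var ⇓nil
⇓remove (w ∷ ws) []       = ⇓weaken (m≤m+n 5 _) (⇓case-cons ⇓var (⇓case-nil ⇓var ⇓var))
⇓remove (w ∷ ws) (true ∷ bs) =
  ⇓weaken (m≤n+m _ 2) (⇓case-cons ⇓var (⇓case-cons ⇓var
    (⇓cons (⇓case-cons ⇓var ⇓nil) (⇓call (⇓var ⇓∷ ⇓var ⇓∷ ⇓[]) (⇓remove ws bs)))))
⇓remove (w ∷ ws) (false ∷ bs) =
  ⇓weaken (m≤n+m _ 2) (⇓case-cons ⇓var (⇓case-cons ⇓var
    (⇓cons (⇓case-nil ⇓var ⇓var) (⇓call (⇓var ⇓∷ ⇓var ⇓∷ ⇓[]) (⇓remove ws bs)))))

⇓append : ∀ xs ys →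
  encodeList xs ∷ encodeList ys ∷ [] ⊢ body append ⇓ encodeList (xs ++ ys) within length xs * 13 + 3
⇓append []       ys = ⇓case-nil ⇓var ⇓var
⇓append (x ∷ xs) ys =
  ⇓weaken (m≤n+m _ 6) (⇓case-cons ⇓var (⇓cons ⇓var (⇓call (⇓var ⇓∷ ⇓var ⇓∷ ⇓[]) (⇓append xs ys))))

⇓minus : ∀ d xs →
  encodeℕ d ∷ encodeList xs ∷ [] ⊢ body minus ⇓ encodeℕ (d ∸ length xs) within length xs * 13 + 5
⇓minus zero    xs rewrite 0∸n≡0 (length xs) =
  ⇓weaken (≤-trans (m≤m+n 3 2) (m≤n+m 5 _)) (⇓case-nil ⇓var ⇓nil)
⇓minus (suc d) []       = ⇓case-cons ⇓var (⇓case-nil ⇓var ⇓var)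
⇓minus (suc d) (x ∷ xs) =
  ⇓weaken (m≤n+m _ 6) (⇓case-cons ⇓var (⇓case-cons ⇓var (⇓call (⇓var ⇓∷ ⇓var ⇓∷ ⇓[]) (⇓minus d xs))))

-- Sets of inner vertices

module _ {A : Set} where

  Unique-resp-↭ : ∀ {xs ys : List A} → xs ↭ ys → Unique xs → Unique ys
  Unique-resp-↭ p = PermSetoid.Unique-resp-↭ (setoid A) (↭⇒↭ₛ p)

  Unique-++⁻ˡ : ∀ xs {ys : List A} → Unique (xs ++ ys) → Unique xs
  Unique-++⁻ˡ []       u        = []
  Unique-++⁻ˡ (x ∷ xs) (x∉ ∷ u) = All.++⁻ˡ xs x∉ ∷ Unique-++⁻ˡ xs u

  Unique-++⁻ʳ : ∀ xs {ys : List A} → Unique (xs ++ ys) → Unique ys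
  Unique-++⁻ʳ []       u        = u
  Unique-++⁻ʳ (x ∷ xs) (_  ∷ u) = Unique-++⁻ʳ xs u

  Unique⇒disjoint : ∀ xs {ys : List A} {x} → Unique (xs ++ ys) → x ∈ xs → x ∉ ys
  Unique⇒disjoint (_ ∷ xs) (x∉ ∷ _) (here refl) x∈ys = All.lookup (All.++⁻ʳ xs x∉) x∈ys refl
  Unique⇒disjoint (_ ∷ xs) (_  ∷ u) (there x∈)  x∈ys = Unique⇒disjoint xs u x∈ x∈ys

  Unique⇒length≤ : ∀ {xs ys : List A} → Unique xs → xs ⊆ ys → length xs ≤ length ys
  Unique⇒length≤ {[]}     _        _   = z≤n
  Unique⇒length≤ {x ∷ xs} u@(x∉ ∷ u′) sub with us , vs , refl ← ∈-∃++ (sub (here refl)) =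
    ≤-trans (s≤s (Unique⇒length≤ u′ sub′)) (≤-reflexive (sym (↭-length (shift x us vs))))
    where
    sub′ : xs ⊆ us ++ vs
    sub′ y∈ with ∈-resp-↭ (shift x us vs) (sub (there y∈))
    ... | here refl = contradiction y∈ (Unique.Unique[x∷xs]⇒x∉xs u)
    ... | there y∈′ = y∈′

module _ {n : ℕ} where

  -- Counting by a duplicate-free list of witnesses spares a decision procedure for `Q`.
  AtLeast : ℕ → (Fin n → Set) → Set
  AtLeast k Q = Σ[ L ∈ List (Fin n) ] Unique L × k ≤ length L × (∀ {x} → x ∈ L → Q x)

  Unique⇒length≤n : ∀ {xs : List (Fin n)} → Unique xs → length xs ≤ n
  Unique⇒length≤n u =
    ≤-trans (Unique⇒length≤ u λ {x} _ → ∈-allFin x) (≤-reflexive (length-tabulate {n = n} id))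

  -- Rename `a` to `b` in the list. As `b` fails `Q`, it does not occur there before, so no
  -- repetition arises; if `a` is absent, nothing changes.
  AtLeast-exchange : ∀ {k} {Q Q′ : Fin n → Set} a b → ¬ Q b → Q′ b → (∀ {x} → Q x → x ≢ a → Q′ x) →
                     AtLeast k Q → AtLeast k Q′
  AtLeast-exchange {k} {Q} {Q′} a b ¬Qb Q′b Q⇒Q′ (L , u , k≤ , LQ) =
    map trade L , unique u LQ , subst (k ≤_) (sym (length-map trade L)) k≤ , all
    where
    trade : Fin n → Fin n
    trade x with x ≟ a
    ... | yes _ = b
    ... | no  _ = x

    trade-inj : ∀ {x y} → x ≢ b → y ≢ b → trade x ≡ trade y → x ≡ y
    trade-inj {x} {y} x≢b y≢b eq with x ≟ a | y ≟ a
    ... | yes p | yes q = trans p (sym q)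
    ... | yes p | no  q = contradiction (sym eq) y≢b
    ... | no  p | yes q = contradiction eq x≢b
    ... | no  p | no  q = eq

    ≢b : ∀ {x} → Q x → x ≢ b
    ≢b Qx refl = ¬Qb Qx

    unique : ∀ {xs} → Unique xs → (∀ {x} → x ∈ xs → Q x) → Unique (map trade xs)
    unique []       _  = []
    unique (x∉ ∷ u) Qs =
      All.map⁺ (All.tabulate λ y∈ eq →
        All.lookup x∉ y∈ (trade-inj (≢b (Qs (here refl))) (≢b (Qs (there y∈))) eq))
      ∷ unique u (Qs ∘ there)

    all : ∀ {x} → x ∈ map trade L → Q′ x
    all x∈ with y , y∈ , refl ← ∈-map⁻ trade x∈ with y ≟ a
    ... | yes _   = Q′b
    ... | no  y≢a = Q⇒Q′ (LQ y∈) y≢a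

-- Growing a connected set of inner vertices

module Growth {n : ℕ} (arc : Fin n → Fin n → Bool) (r : Fin n) where

  open import Data.List.Membership.DecPropositional (_≟_ {n}) using (_∈?_)

  variable
    S S′ X B : List (Fin n)
    x y u : Fin n

  -- The root is covered by convention, so that it is the only leaf when S is empty.
  covered : List (Fin n) → Fin n → Bool
  covered []      x = does (x ≟ r)
  covered (s ∷ S) x = covered S x ∨ arc s x

  covered-root : ∀ S → T (covered S r)
  covered-root [] with r ≟ r
  ... | yes _   = _
  ... | no  r≢r = r≢r refl
  covered-root (s ∷ S) = from T-∨ (inj₁ (covered-root S))

  covered-arc : u ∈ S → T (arc u x) → T (covered S x)
  covered-arc             (here refl) a = from T-∨ (inj₂ a)
  covered-arc {S = s ∷ S} (there u∈)  a = from (T-∨ {covered S _}) (inj₁ (covered-arc u∈ a))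

  covered⁻ : ∀ S → T (covered S x) → x ≡ r ⊎ ∃ λ s → s ∈ S × T (arc s x)
  covered⁻ {x} [] c with x ≟ r
  ... | yes eq = inj₁ eq
  covered⁻ {x} (s ∷ S) c with to (T-∨ {covered S x}) c
  ... | inj₂ a = inj₂ (s , here refl , a)
  ... | inj₁ c′ with covered⁻ S c′
  ...   | inj₁ eq            = inj₁ eq
  ...   | inj₂ (t , t∈ , a) = inj₂ (t , there t∈ , a)

  covered-mono : S ⊆ S′ → T (covered S x) → T (covered S′ x)
  covered-mono {S} {S′} sub c with covered⁻ S c
  ... | inj₁ refl          = covered-root S′
  ... | inj₂ (s , s∈ , a) = covered-arc (sub s∈) a

  data Conn (S : List (Fin n)) : Fin n → Set where
    root : r ∈ S → Conn S r
    step : Conn S x → T (arc x y) → y ∈ S → Conn S y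

  Connected : List (Fin n) → Set
  Connected S = ∀ {x} → x ∈ S → Conn S x

  Conn-∈ : Conn S x → x ∈ S
  Conn-∈ (root r∈)    = r∈
  Conn-∈ (step _ _ x∈) = x∈

  Conn-covered : Conn S x → T (covered S x)
  Conn-covered {S} (root _) = covered-root S
  Conn-covered (step c a _) = covered-arc (Conn-∈ c) a

  Conn-mono : S ⊆ S′ → Conn S x → Conn S′ x
  Conn-mono sub (root r∈)     = root (sub r∈)
  Conn-mono sub (step c a x∈) = step (Conn-mono sub c) a (sub x∈)

  Connected-∷ : Connected S → T (covered S u) → Connected (u ∷ S)
  Connected-∷ {S} conn c (there x∈) = Conn-mono there (conn x∈)
  Connected-∷ {S} conn c (here refl) with covered⁻ S c
  ... | inj₁ refl          = root (here refl)
  ... | inj₂ (s , s∈ , a) = step (Conn-mono there (conn s∈)) a (here refl)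

  Boundary : List (Fin n) → Fin n → Set
  Boundary S x = T (covered S x) × x ∉ S

  -- The property decided at a node of the search tree: the vertices of `S` are committed to be
  -- inner, those of `X` to stay outside.
  record Good (k : ℕ) (S X : List (Fin n)) : Set where
    constructor good
    field
      {inner}   : List (Fin n)
      extends   : S ⊆ inner
      avoids    : x ∈ X → x ∉ inner
      connected : Connected inner
      boundary  : AtLeast k (Boundary inner)

  -- Follow a path from `r` inside `S′`: its first vertex outside `S` would lie on the boundary of
  -- `S`, hence in `X`, which `S′` avoids.
  stuck : Connected S′ → (∀ {x} → x ∈ X → x ∉ S′) → (∀ {x} → Boundary S x → x ∈ X) → S′ ⊆ S
  stuck {S′} {X} {S} conn avoids red x∈ = go (conn x∈)
    where
    enter : T (covered S x) → x ∈ S′ → x ∈ S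
    enter {x} c x∈S′ with x ∈? S
    ... | yes x∈S = x∈S
    ... | no  x∉S = contradiction x∈S′ (avoids (red (c , x∉S)))

    go : Conn S′ x → x ∈ S
    go (root r∈)     = enter (covered-root S) r∈
    go (step c a x∈) = enter (covered-arc (go c) a) x∈

  -- Removing u from the inner vertices S′ loses at most the leaf w, and u itself becomes a leaf.
  demote : ∀ {k} w → Connected S → Boundary S u →
           (∀ {x} → T (arc u x) → ¬ T (covered S x) → x ≡ w) →
           Connected S′ → u ∷ S ⊆ S′ → (∀ {x} → x ∈ X → x ∉ S′) →
           (∀ {x} → T (arc u x) → ¬ T (covered S x) → x ∉ S′) →
           AtLeast k (Boundary S′) → Good k S (u ∷ X)
  demote {S} {u} {S′} {X} w connS (cu , u∉S) new≡w connS′ sub avoids new∉ leaves =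
    good sub⁻ avoids⁻
      (λ x∈ → let x∈S′ , x≢u = ∈-filter⁻ ≢u? {xs = S′} x∈ in go x≢u (connS′ x∈S′))
      (AtLeast-exchange w u (λ (_ , u∉) → u∉ (sub (here refl))) (covered-mono sub⁻ cu , u∉S⁻)
        (λ (c , x∉) x≢w → keep c x∉ x≢w , x∉ ∘ proj₁ ∘ ∈-filter⁻ ≢u?) leaves)
    where
    ≢u? = λ x → ¬? (x ≟ u)
    S⁻ = filter ≢u? S′

    u∉S⁻ : u ∉ S⁻
    u∉S⁻ u∈ = proj₂ (∈-filter⁻ ≢u? {xs = S′} u∈) refl

    sub⁻ : S ⊆ S⁻
    sub⁻ x∈ = ∈-filter⁺ ≢u? (sub (there x∈)) λ { refl → u∉S x∈ }

    avoids⁻ : x ∈ u ∷ X → x ∉ S⁻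
    avoids⁻ (here refl) = u∉S⁻
    avoids⁻ (there x∈)  = avoids x∈ ∘ proj₁ ∘ ∈-filter⁻ ≢u?

    enter : x ∈ S′ → x ≢ u → T (covered S x) → Conn S⁻ x
    enter x∈ x≢u c with covered⁻ S c
    ... | inj₁ refl = root (∈-filter⁺ ≢u? x∈ x≢u)
    ... | inj₂ (s , s∈ , a) = step (Conn-mono sub⁻ (connS s∈)) a (∈-filter⁺ ≢u? x∈ x≢u)

    -- Where the path passes through `u`, the next vertex lies in `S′`, so by `new∉` it is covered
    -- by `S` and `enter` reaches it without `u`.
    go : x ≢ u → Conn S′ x → Conn S⁻ x
    go x≢u (root r∈) = root (∈-filter⁺ ≢u? r∈ x≢u)
    go {x} x≢u (step {p} c a x∈) with p ≟ u
    ... | no p≢u = step (go p≢u c) a (∈-filter⁺ ≢u? x∈ x≢u)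
    ... | yes refl with T? (covered S x)
    ...   | yes cx = enter x∈ x≢u cx
    ...   | no ¬cx = contradiction x∈ (new∉ a ¬cx)

    -- A vertex other than `w` with an arc from `u` is covered by `S` already, so it stays covered
    -- without `u`.
    keep : T (covered S′ x) → x ∉ S′ → x ≢ w → T (covered S⁻ x)
    keep {x} c x∉ x≢w with covered⁻ S′ c
    ... | inj₁ refl = covered-root S⁻
    ... | inj₂ (s , s∈ , a) with s ≟ u
    ...   | no s≢u = covered-arc (∈-filter⁺ ≢u? s∈ s≢u) a
    ...   | yes refl with T? (covered S x)
    ...     | yes cx = covered-mono sub⁻ cx
    ...     | no ¬cx = contradiction (new≡w a ¬cx) x≢w

  -- X and B are the red and the blue leaves.
  record State (S X B : List (Fin n)) : Set where
    field
      connected : Connected S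
      unique    : Unique (B ++ X ++ S)
      complete  : T (covered S x) → x ∈ B ++ X ++ S
      sound     : x ∈ B ++ X ++ S → T (covered S x)

    boundary⇒ : Boundary S x → x ∈ B ++ X
    boundary⇒ {x} (c , x∉S) with ∈-++⁻ B (complete c)
    ... | inj₁ x∈B = ∈-++⁺ˡ x∈B
    ... | inj₂ x∈XS with ∈-++⁻ X x∈XS
    ...   | inj₁ x∈X = ∈-++⁺ʳ B x∈X
    ...   | inj₂ x∈S = contradiction x∈S x∉S

    unique-assoc : Unique ((B ++ X) ++ S)
    unique-assoc = subst Unique (sym (++-assoc B X S)) unique

    ⇒boundary : x ∈ B ++ X → Boundary S x
    ⇒boundary x∈ =
      sound (subst (_ ∈_) (++-assoc B X S) (∈-++⁺ˡ x∈)) , Unique⇒disjoint (B ++ X) unique-assoc x∈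

  open State

  redden : State S X (u ∷ B) → State S (u ∷ X) B
  redden {S} {X} {u} {B} st = record
    { connected = connected st
    ; unique    = Unique-resp-↭ (↭-sym rearrange) (unique st)
    ; complete  = ∈-resp-↭ (↭-sym rearrange) ∘ complete st
    ; sound     = sound st ∘ ∈-resp-↭ rearrange
    }
    where
    rearrange : B ++ u ∷ X ++ S ↭ u ∷ B ++ X ++ S
    rearrange = shift u B (X ++ S)

  private
    new? : ∀ S u x → Dec (T (arc u x ∧ not (covered S x)))
    new? S u x = T? (arc u x ∧ not (covered S x))

  -- The test and the order of vertices agree with those in `⇓select`, so the list computed by the
  -- program encodes exactly this one.
  news : List (Fin n) → Fin n → List (Fin n)
  news S u = filter (new? S u) (allFin n)

  ∈-news⁺ : T (arc u x) → ¬ T (covered S x) → x ∈ news S u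
  ∈-news⁺ {u} {x} {S} a ¬c =
    ∈-filter⁺ (new? S u) (∈-allFin x) (both (arc u x) (covered S x) a ¬c)
    where
    both : ∀ a c → T a → ¬ T c → T (a ∧ not c)
    both true false _ _  = _
    both true true  _ ¬c = ¬c _

  ∈-news⁻ : x ∈ news S u → T (arc u x) × ¬ T (covered S x)
  ∈-news⁻ {x} {S} {u} x∈ =
    both (arc u x) (covered S x) (proj₂ (∈-filter⁻ (new? S u) {xs = allFin n} x∈))
    where
    both : ∀ a c → T (a ∧ not c) → T a × ¬ T c
    both true false _ = _ , λ ()

  news-unique : ∀ S u → Unique (news S u)
  news-unique S u = Unique.filter⁺ _ (Unique.allFin⁺ n)

  grow : State S X (u ∷ B) → State (u ∷ S) X (news S u ++ B)
  grow {S} {X} {u} {B} st = record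
    { connected = Connected-∷ (connected st) (sound st (here refl))
    ; unique    = Unique-resp-↭ rearrange
                    (Unique.++⁺ (news-unique S u) (unique st)
                      λ (x∈N , x∈) → proj₂ (∈-news⁻ {S = S} x∈N) (sound st x∈))
    ; complete  = ∈-resp-↭ rearrange ∘ complete′
    ; sound     = sound′ ∘ ∈-resp-↭ (↭-sym rearrange)
    }
    where
    N = news S u

    rearrange : N ++ u ∷ B ++ X ++ S ↭ (N ++ B) ++ X ++ u ∷ S
    rearrange = ↭-trans
      (++⁺ˡ N (↭-trans (↭-sym (shift u B (X ++ S))) (++⁺ˡ B (↭-sym (shift u X S)))))
      (↭-reflexive (sym (++-assoc N B (X ++ u ∷ S))))

    complete′ : T (covered (u ∷ S) x) → x ∈ N ++ u ∷ B ++ X ++ S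
    complete′ {x} c with T? (covered S x)
    ... | yes cx = ∈-++⁺ʳ N (complete st cx)
    ... | no ¬cx with to (T-∨ {covered S x}) c
    ...   | inj₁ cx = contradiction cx ¬cx
    ...   | inj₂ a  = ∈-++⁺ˡ (∈-news⁺ {S = S} a ¬cx)

    sound′ : x ∈ N ++ u ∷ B ++ X ++ S → T (covered (u ∷ S) x)
    sound′ {x} x∈ with ∈-++⁻ N x∈
    ... | inj₁ x∈N  = from (T-∨ {covered S x}) (inj₂ (proj₁ (∈-news⁻ {S = S} x∈N)))
    ... | inj₂ x∈′ = covered-mono {S = S} there (sound st x∈′)

  module _ {k : ℕ} where

    -- `S` itself is the witness, with all coloured leaves as its boundary.
    enough : State S X B → k ≤ length X + length B → Good k S X
    enough {S} {X} {B} st k≤ = good id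
      (λ x∈ → proj₂ (⇒boundary st (∈-++⁺ʳ B x∈))) (connected st)
      (B ++ X , Unique-++⁻ˡ (B ++ X) (unique-assoc st) ,
       ≤-trans k≤ (≤-reflexive (trans (+-comm (length X) (length B)) (sym (length-++ B)))) , ⇒boundary st)

    -- By `stuck` the inner set of a solution cannot exceed `S`, so all its leaves are among the red
    -- ones.
    exhausted : State S X [] → Good k S X → k ≤ length X
    exhausted {S} {X} st (good sub avoids conn (L , uL , k≤ , LQ)) =
      ≤-trans k≤ (Unique⇒length≤ uL λ x∈ →
        let c , x∉ = LQ x∈
        in boundary⇒ st (covered-mono (stuck conn avoids (boundary⇒ st)) c , x∉ ∘ sub))

    Good-red : Good k S (u ∷ X) → Good k S X
    Good-red (good sub avoids conn bd) = good sub (avoids ∘ there) conn bd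

    Good-inner : Good k (u ∷ S) X → Good k S X
    Good-inner (good sub avoids conn bd) = good (sub ∘ there) avoids conn bd

    Good-split : Good k S X → Good k S (u ∷ X) ⊎ Good k (u ∷ S) X
    Good-split {u = u} (good {S′} sub avoids conn bd) with u ∈? S′
    ... | yes u∈ = inj₂ (good (λ { (here refl) → u∈ ; (there x∈) → sub x∈ }) avoids conn bd)
    ... | no  u∉ = inj₁ (good sub (λ { (here refl) → u∉ ; (there x∈) → avoids x∈ }) conn bd)

    -- Justifies expanding without branching: if at most one vertex is new and it stays a leaf, then
    -- `u` as a leaf does equally well. With no new vertex, `w` is arbitrary.
    demote-news : ∀ w → State S X (u ∷ B) → (∀ {x} → x ∈ news S u → x ≡ w) →
                  Good k (u ∷ S) (news S u ++ X) → Good k S (u ∷ X)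
    demote-news {S} {u = u} w st new≡w (good sub avoids conn bd) =
      demote w (connected st) (⇒boundary st (here refl))
        (λ a ¬c → new≡w (∈-news⁺ {S = S} a ¬c)) conn sub (avoids ∘ ∈-++⁺ʳ (news S u))
        (λ a ¬c → avoids (∈-++⁺ˡ (∈-news⁺ {S = S} a ¬c))) bd

-- The branching search

-- `pass n` covers any of the four list functions on lists of length at most `n`; one expansion
-- calls each of them at most once.
pass step-cost : ℕ → ℕ
pass n = n * 13 + 5
step-cost n = 40 + 4 * pass n

-- Bounds the cost of a search with branching measure m: a chain of at most n expansions and two subsearches.
budget : ℕ → ℕ → ℕ
budget n zero    = 3 + n * step-cost n
budget n (suc m) = 20 + n * step-cost n + (budget n m + budget n m)

slack : ∀ {a b} c → a + c ≡ b → a ≤ b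
slack c refl = m≤m+n _ c

-- The left-hand sides below are the bounds computed by the ⇓ combinators for the branches of expand, search
-- and roots; A stands for pass n.
cost-none : ∀ A F R → suc (suc (2 + A) + 3) ≤ 40 + 4 * A + F + R
cost-none A F R = slack (33 + 3 * A + F + R) (lemma A F R)
  where
  lemma : ∀ A F R → suc (suc (2 + A) + 3) + (33 + 3 * A + F + R) ≡ 40 + 4 * A + F + R
  lemma = solve-∀

cost-one : ∀ A F R →
  suc (suc (2 + A) + suc (1 + suc (1 + suc (suc (2 + A) + 3 + (F + R))))) ≤ 40 + 4 * A + F + R
cost-one A F R = slack (25 + 2 * A) (lemma A F R)
  where
  lemma : ∀ A F R →
    suc (suc (2 + A) + suc (1 + suc (1 + suc (suc (2 + A) + 3 + (F + R))))) + (25 + 2 * A)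
      ≡ 40 + 4 * A + F + R
  lemma = solve-∀

cost-many : ∀ A F R →
  suc (suc (2 + A) +
    suc (1 + suc (1 + suc (suc (2 + A) + (suc (2 + A) + (suc (2 + A) + 0)) + R)))) ≤ 40 + 4 * A + F + R
cost-many A F R = slack (22 + F) (lemma A F R)
  where
  lemma : ∀ A F R →
    suc (suc (2 + A) +
      suc (1 + suc (1 + suc (suc (2 + A) + (suc (2 + A) + (suc (2 + A) + 0)) + R)))) + (22 + F)
      ≡ 40 + 4 * A + F + R
  lemma = solve-∀

cost-red : ∀ F R → suc (1 + suc (1 + suc (suc (3 + R) + 3))) ≤ 20 + F + (R + R)
cost-red F R = slack (8 + F + R) (lemma F R)
  where
  lemma : ∀ F R → suc (1 + suc (1 + suc (suc (3 + R) + 3))) + (8 + F + R) ≡ 20 + F + (R + R)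
  lemma = solve-∀

cost-inner : ∀ F R →
  suc (1 + suc (1 + suc (suc (3 + R) + suc (4 + (F + R))))) ≤ 20 + F + (R + R)
cost-inner F R = slack 6 (lemma F R)
  where
  lemma : ∀ F R →
    suc (1 + suc (1 + suc (suc (3 + R) + suc (4 + (F + R))))) + 6 ≡ 20 + F + (R + R)
  lemma = solve-∀

-- Correctness and cost of the search

module Rows {n : ℕ} (arc : Fin n → Fin n → Bool) where

  row : Fin n → Value
  row u = bits (map (arc u) (allFin n))

  rows : List (Fin n) → Value
  rows B = encodeList (map row B)

  length-allFin : length (allFin n) ≡ n
  length-allFin = length-tabulate {n = n} id

module Search {n′ : ℕ} (arc : Fin (suc n′) → Fin (suc n′) → Bool) (r : Fin (suc n′)) (k : ℕ) where

  private
    n = suc n′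

  open Rows arc
  open Growth arc r

  entry : List (Fin n) → Fin n → Value
  entry S x = if covered S x then nil else row x

  matrix : List (Fin n) → Value
  matrix S = encodeList (map (entry S) (allFin n))

  -- Blue leaves count too, since stopping at this point would keep them as leaves.
  deficit : List (Fin n) → List (Fin n) → ℕ
  deficit X B = k ∸ (length X + length B)

  length-news : ∀ S u → length (news S u) ≤ n
  length-news S u = Unique⇒length≤n (news-unique S u)

  ⇓select-news : ∀ S u {N} → news S u ≡ N →
    matrix S ∷ row u ∷ [] ⊢ body select ⇓ rows N within pass n
  ⇓select-news S u refl =
    ⇓weaken (+-mono-≤ (*-monoˡ-≤ 13 (≤-reflexive length-allFin)) (m≤m+n 3 2))
      -- The vertex set is nonempty, so a row is a `cons` and differs from the `nil` of a covered
      -- vertex.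
      (⇓select (arc u) (covered S) row (λ x → _ , _ , refl) (allFin n))

  ⇓remove-matrix : ∀ S S′ bs → erase (map (entry S) (allFin n)) bs ≡ map (entry S′) (allFin n) →
    matrix S ∷ bits bs ∷ [] ⊢ body remove ⇓ matrix S′ within pass n
  ⇓remove-matrix S S′ bs eq =
    ⇓result (cong encodeList eq)
      (⇓weaken
        (+-mono-≤ (*-monoˡ-≤ 13 (≤-reflexive (trans (length-map (entry S) (allFin n)) length-allFin)))
                  (m≤m+n 3 2))
        (⇓remove (map (entry S) (allFin n)) bs))

  erase-row : ∀ S u xs → erase (map (entry S) xs) (map (arc u) xs) ≡ map (entry (u ∷ S)) xs
  erase-row S u []       = refl
  erase-row S u (x ∷ xs) = cong₂ _∷_ (lemma (arc u x) (covered S x)) (erase-row S u xs)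
    where
    lemma : ∀ a c →
      (if a then nil else (if c then nil else row x)) ≡ (if c ∨ a then nil else row x)
    lemma true  true  = refl
    lemma true  false = refl
    lemma false true  = refl
    lemma false false = refl

  ⇓remove-row : ∀ S u → matrix S ∷ row u ∷ [] ⊢ body remove ⇓ matrix (u ∷ S) within pass n
  ⇓remove-row S u = ⇓remove-matrix S (u ∷ S) _ (erase-row S u (allFin n))

  ⇓append-rows : ∀ N B → length N ≤ n →
    rows N ∷ rows B ∷ [] ⊢ body append ⇓ rows (N ++ B) within pass n
  ⇓append-rows N B le =
    ⇓result (cong encodeList (sym (map-++ row N B)))
      (⇓weaken (+-mono-≤ (*-monoˡ-≤ 13 (≤-trans (≤-reflexive (length-map row N)) le)) (m≤m+n 3 2))
        (⇓append (map row N) (map row B)))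

  ⇓minus-rows : ∀ d N → length N ≤ n →
    encodeℕ d ∷ rows N ∷ [] ⊢ body minus ⇓ encodeℕ (d ∸ length N) within pass n
  ⇓minus-rows d N le =
    ⇓result (cong (λ l → encodeℕ (d ∸ l)) (length-map row N))
      (⇓weaken (+-monoˡ-≤ 5 (*-monoˡ-≤ 13 (≤-trans (≤-reflexive (length-map row N)) le)))
        (⇓minus d (map row N)))

  Decides : ∀ {m} → Vec Value m → Exp arity m → Set → ℕ → Set
  Decides ρ e Q b = Σ[ answer ∈ Bool ] ρ ⊢ e ⇓ encodeBool answer within b × (T answer ⇔ Q)

  -- The measure need not drop when truncation brings d to 0, but then the search stops at once.
  SearchSpec : ℕ → Set
  SearchSpec m = ∀ S X B d → State S X B → deficit X B ≡ d → d ≡ 0 ⊎ length B + 2 * d ≤ m →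
    Decides (matrix S ∷ rows B ∷ encodeℕ d ∷ []) (body search) (Good k S X) (budget n m)

  deficit-news : ∀ X (u : Fin n) B w N → deficit X (w ∷ N ++ B) ≡ deficit X (u ∷ B) ∸ length N
  deficit-news X u B w N = sym (trans (∸-+-assoc k (length X + suc (length B)) (length N))
    (cong (k ∸_) (trans (lemma (length X) (length B) (length N))
      (cong (λ l → length X + suc l) (sym (length-++ N))))))
    where
    lemma : ∀ x b s → x + suc b + s ≡ x + suc (s + b)
    lemma = solve-∀

  -- With `2 + s` new vertices the blue leaves other than `u` grow from `b` to `b + 2 + s`, while
  -- `d` falls by `1 + s`; the sum changes by `- s`, unless `d` is cut off at 0.
  measure-decreases : ∀ b d s m → b + 2 * d ≤ m →
    d ∸ suc s ≡ 0 ⊎ suc (suc s + b) + 2 * (d ∸ suc s) ≤ m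
  measure-decreases b d s m le with d ∸ suc s in eq
  ... | zero  = inj₁ refl
  ... | suc e = inj₂ (≤-trans (≤-trans (m≤m+n _ s) (≤-reflexive (lemma b s (suc e))))
                  (subst (λ d → b + 2 * d ≤ m) d≡ le))
    where
    lemma : ∀ b s d → suc (suc s + b) + 2 * d + s ≡ b + 2 * (d + suc s)
    lemma = solve-∀
    d≡ : d ≡ suc e + suc s
    d≡ = sym (trans (cong (_+ suc s) (sym eq))
      (m∸n+n≡m {d} {suc s} (<⇒≤ (m∸n≢0⇒n<m λ z → 0≢1+n (trans (sym z) eq)))))

  -- S grows along a chain of forced expansions, so f = n ∸ length S steps suffice.
  expand-correct : ∀ m → SearchSpec m → ∀ f S X B u d → State S X (u ∷ B) → n ≤ length S + f →
    deficit X (u ∷ B) ≡ d → length B + 2 * d ≤ m → ¬ Good k S (u ∷ X) →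
    Decides (matrix S ∷ row u ∷ rows B ∷ encodeℕ d ∷ []) (body expand)
      (Good k (u ∷ S) X) (f * step-cost n + budget n m)
  -- Out of fuel: `u` and `S` together would be more than `n` distinct vertices.
  expand-correct m search-m zero S X B u d st fuel d≡ le ¬red =
    contradiction
      (≤-trans (Unique⇒length≤n unique-u∷S) (≤-trans fuel (≤-reflexive (+-identityʳ _)))) 1+n≰n
    where
    unique-u∷S = Unique-++⁻ʳ X (Unique-++⁻ʳ (news S u ++ B) (State.unique (grow st)))
  expand-correct m search-m (suc f) S X B u d st fuel d≡ le ¬red with news S u in eq
  ... | [] = false ,
    ⇓weaken (cost-none (pass n) (f * step-cost n) (budget n m))
      (⇓let (⇓call (⇓var ⇓∷ ⇓var ⇓∷ ⇓[]) (⇓select-news S u eq)) (⇓case-nil ⇓var ⇓nil)) ,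
    -- Nothing is new, so `u` could be red, against `¬red`; the first argument `u` is a placeholder.
    mk⇔ (λ ()) (λ g → ¬red (demote-news u st (λ x∈ → contradiction (subst (_ ∈_) eq x∈) λ ())
      (subst (λ N → Good k (u ∷ S) (N ++ X)) (sym eq) g)))
  ... | w ∷ [] =
    let st′ = subst (λ N → State (u ∷ S) X (N ++ B)) eq (grow st)
        -- If `w` could be red, so could `u`. This is the hypothesis needed to continue the chain at
        -- `w`.
        ¬red′ = λ g → ¬red (demote-news w st (λ x∈ → single (subst (_ ∈_) eq x∈))
                  (subst (λ N → Good k (u ∷ S) (N ++ X)) (sym eq) g))
        answer , run , correct = expand-correct m search-m f (u ∷ S) X B w d st′
          (≤-trans fuel (≤-reflexive (+-suc _ f))) d≡ le ¬red′
    in answer ,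
       ⇓weaken (cost-one (pass n) (f * step-cost n) (budget n m))
         (⇓let (⇓call (⇓var ⇓∷ ⇓var ⇓∷ ⇓[]) (⇓select-news S u eq))
         (⇓case-cons ⇓var (⇓case-nil ⇓var
           (⇓call (⇓call (⇓var ⇓∷ ⇓var ⇓∷ ⇓[]) (⇓remove-row S u)
                   ⇓∷ ⇓var ⇓∷ ⇓var ⇓∷ ⇓var ⇓∷ ⇓[]) run)))) ,
       mk⇔ (Good-inner ∘ to correct)
           (λ g → [ (λ g′ → contradiction g′ ¬red′) , from correct ]′ (Good-split g))
    where
    single : ∀ {x} → x ∈ w ∷ [] → x ≡ w
    single (here eq) = eq
  ... | w ∷ N@(w′ ∷ N′) =
    let st′ = subst (λ N → State (u ∷ S) X (N ++ B)) eq (grow st)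
        answer , run , correct = search-m (u ∷ S) X (w ∷ N ++ B) (d ∸ length N) st′
          -- One new leaf only replaces `u`, so the gain is the length of the tail `N`.
          (trans (deficit-news X u B w N) (cong (_∸ length N) d≡))
          (subst (λ l → _ ⊎ suc (suc l) + 2 * (d ∸ length N) ≤ m) (sym (length-++ N′))
            (measure-decreases (length B) d (length N′) m le))
        len = subst (λ N → length N ≤ n) eq (length-news S u)
    in answer ,
       ⇓weaken (cost-many (pass n) (f * step-cost n) (budget n m))
         (⇓let (⇓call (⇓var ⇓∷ ⇓var ⇓∷ ⇓[]) (⇓select-news S u eq))
         (⇓case-cons ⇓var (⇓case-cons ⇓var
           (⇓call (⇓call (⇓var ⇓∷ ⇓var ⇓∷ ⇓[]) (⇓remove-row S u)
                   ⇓∷ ⇓call (⇓var ⇓∷ ⇓var ⇓∷ ⇓[]) (⇓append-rows (w ∷ N) B len)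
                   ⇓∷ ⇓call (⇓var ⇓∷ ⇓var ⇓∷ ⇓[]) (⇓minus-rows d N (<⇒≤ len))
                   ⇓∷ ⇓[]) run)))) ,
       correct

  deficit-red : ∀ (u : Fin n) X B → deficit (u ∷ X) B ≡ deficit X (u ∷ B)
  deficit-red u X B = cong (k ∸_) (sym (+-suc (length X) (length B)))

  private
    early : ∀ m → 5 ≤ budget n m
    early zero    = m≤m+n 5 _
    early (suc m) = m≤m+n 5 _

  search-correct : ∀ m → SearchSpec m
  search-correct m S X B zero st d≡ le = true , ⇓weaken (early m) (⇓case-nil ⇓var ⇓yes) ,
    mk⇔ (λ _ → enough st (m∸n≡0⇒m≤n d≡)) (λ _ → _)
  search-correct m S X [] (suc d) st d≡ le = false ,
    ⇓weaken (early m) (⇓case-cons ⇓var (⇓case-nil ⇓var ⇓nil)) ,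
    mk⇔ (λ ()) λ g → 0≢1+n (trans (sym (m≤n⇒m∸n≡0 (≤-trans (exhausted st g) (m≤m+n _ 0)))) d≡)
  search-correct zero S X (u ∷ B) (suc d) st d≡ (inj₂ ())
  search-correct (suc m) S X (u ∷ B) (suc d) st d≡ (inj₂ (s≤s le))
    with search-correct m S (u ∷ X) B (suc d) (redden st) (trans (deficit-red u X B) d≡) (inj₂ le)
  ... | true , run , correct = true ,
    ⇓weaken (cost-red (n * step-cost n) (budget n m))
      (⇓case-cons ⇓var (⇓case-cons ⇓var (⇓case-cons
        (⇓call (⇓var ⇓∷ ⇓var ⇓∷ ⇓var ⇓∷ ⇓[]) run) ⇓yes))) ,
    mk⇔ (λ _ → Good-red (to correct _)) (λ _ → _)
  ... | false , run , correct
    -- The negative answer turns `from correct` into a refutation of the red branch, as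
    -- `expand-correct` requires.
    with answer , run′ , correct′ ←
           expand-correct m (search-correct m) n S X B u (suc d) st (m≤n+m n _) d≡ le (from correct) =
    answer ,
    ⇓weaken (cost-inner (n * step-cost n) (budget n m))
      (⇓case-cons ⇓var (⇓case-cons ⇓var (⇓case-nil
        (⇓call (⇓var ⇓∷ ⇓var ⇓∷ ⇓var ⇓∷ ⇓[]) run)
        (⇓call (⇓var ⇓∷ ⇓var ⇓∷ ⇓var ⇓∷ ⇓var ⇓∷ ⇓[]) run′)))) ,
    mk⇔ (Good-inner ∘ to correct′)
        (λ g → [ (λ g′ → contradiction (from correct g′) λ ()) , from correct′ ]′ (Good-split g))

-- The loop over the roots

cost-root : ∀ A b R →
  suc (1 + suc (suc (suc (2 + A) + 4 + b) + suc (6 + (R + 3)))) ≤ 20 + A + b + R + 3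
cost-root A b R = slack 2 (lemma A b R)
  where
  lemma : ∀ A b R →
    suc (1 + suc (suc (suc (2 + A) + 4 + b) + suc (6 + (R + 3)))) + 2 ≡ 20 + A + b + R + 3
  lemma = solve-∀

cost-found : ∀ A b R →
  suc (1 + suc (suc (suc (2 + A) + 4 + b) + 3)) ≤ 20 + A + b + R + 3
cost-found A b R = slack (9 + R) (lemma A b R)
  where
  lemma : ∀ A b R →
    suc (1 + suc (suc (suc (2 + A) + 4 + b) + 3)) + (9 + R) ≡ 20 + A + b + R + 3
  lemma = solve-∀

running-time : ℕ → ℕ → ℕ
running-time n d = 11 + (n * (20 + pass n + budget n (1 + 2 * d)) + 3)

module Roots {n′ : ℕ} (arc : Fin (suc n′) → Fin (suc n′) → Bool) (d : ℕ) where

  open Rows arc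

  private
    n = suc n′
    module S (r : Fin n) = Search arc r (suc d)
    module G (r : Fin n) = Growth arc r

  entry-other : ∀ {u x} → u ≢ x → row x ≡ S.entry u [] x
  entry-other {u} {x} u≢x with x ≟ u
  ... | yes refl = contradiction refl u≢x
  ... | no  _    = refl

  entry-root : ∀ u → nil ≡ S.entry u [] u
  entry-root u with u ≟ u
  ... | yes _   = refl
  ... | no  u≢u = contradiction refl u≢u

  map-entry : ∀ {u} xs → All (u ≢_) xs → map row xs ≡ map (S.entry u []) xs
  map-entry []       []           = refl
  map-entry (x ∷ xs) (u≢x ∷ u∉) = cong₂ _∷_ (entry-other u≢x) (map-entry xs u∉)

  -- Before any vertex is inner only the root is covered, and by uniqueness it occurs at the marked
  -- position alone.
  erase-root : ∀ as u rs → Unique (as ++ u ∷ rs) →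
    erase (map row (as ++ u ∷ rs)) (replicate (length as) false ++ true ∷ []) ≡
    map (S.entry u []) (as ++ u ∷ rs)
  erase-root [] u [] _ = cong (_∷ []) (entry-root u)
  erase-root [] u rs@(_ ∷ _) (u∉ ∷ _) = cong₂ _∷_ (entry-root u) (map-entry rs u∉)
  erase-root (a ∷ as) u rs (a∉ ∷ uniq) =
    cong₂ _∷_ (entry-other λ u≡a → All.lookup a∉ (∈-insert as) (sym u≡a)) (erase-root as u rs uniq)

  initial : ∀ u → G.State u [] [] (u ∷ [])
  initial u = record
    { connected = λ ()
    ; unique    = [] ∷ []
    ; complete  = λ c → here (only c)
    ; sound     = λ { (here refl) → G.covered-root u [] }
    }
    where
    only : ∀ {x} → T (G.covered u [] x) → x ≡ u
    only c with inj₁ eq ← G.covered⁻ u [] c = eq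

  HasRoot : List (Fin n) → Set
  HasRoot rs = ∃ λ r → r ∈ rs × G.Good r (suc d) [] []

  bound : ℕ
  bound = budget n (1 + 2 * d)

  ⇓start : ∀ as u rs {answer} → as ++ u ∷ rs ≡ allFin n →
    S.matrix u [] ∷ rows (u ∷ []) ∷ encodeℕ d ∷ [] ⊢ body search ⇓ encodeBool answer within bound →
    row u ∷ rows rs ∷ rows (allFin n) ∷ rows (u ∷ rs) ∷
      bits (replicate (length as) false ++ true ∷ []) ∷ encodeℕ d ∷ []
      ⊢ call search (call remove (v 2 ∷ v 4 ∷ []) ∷ cons (v 0) nil ∷ v 5 ∷ [])
      ⇓ encodeBool answer within suc (suc (2 + pass n) + 4 + bound)
  ⇓start as u rs split run =
    ⇓call (⇓call (⇓var ⇓∷ ⇓var ⇓∷ ⇓[]) ⇓mark ⇓∷ ⇓cons ⇓var ⇓nil ⇓∷ ⇓var ⇓∷ ⇓[]) run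
    where
    mark = replicate (length as) false ++ true ∷ []

    ⇓mark : rows (allFin n) ∷ bits mark ∷ [] ⊢ body remove ⇓ S.matrix u [] within pass n
    ⇓mark =
      ⇓result (cong encodeList
          (subst (λ xs → erase (map row xs) mark ≡ map (S.entry u []) xs) split
            (erase-root as u rs (subst Unique (sym split) (Unique.allFin⁺ n)))))
        (⇓weaken (+-mono-≤ (*-monoˡ-≤ 13 (≤-reflexive (trans (length-map row (allFin n)) length-allFin)))
                   (m≤m+n 3 2))
          (⇓remove (map row (allFin n)) mark))

  -- `as` lists the roots tried so far; prepending a `nil` to the mark moves it to the next one. `j`
  -- is kept separate because the length of `as ++ u ∷ []` is a successor only up to a proof.
  roots-correct : ∀ as rs j → length as ≡ j → as ++ rs ≡ allFin n →
    Σ[ answer ∈ Bool ]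
      (rows (allFin n) ∷ rows rs ∷ bits (replicate j false ++ true ∷ []) ∷ encodeℕ d ∷ []
        ⊢ body roots ⇓ encodeBool answer within length rs * (20 + pass n + bound) + 3)
      × (T answer ⇔ HasRoot rs)
  roots-correct as [] j _ _ = false , ⇓case-nil ⇓var ⇓nil , mk⇔ (λ ()) λ ()
  roots-correct as (u ∷ rs) j refl split
    -- The root is the only blue leaf at the start, so `d` of the `suc d` leaves are missing and the
    -- measure is `1 + 2 * d`.
    with S.search-correct u (1 + 2 * d) [] [] (u ∷ []) d (initial u) refl (inj₂ ≤-refl)
       | roots-correct (as ++ u ∷ []) rs (suc j) (trans (length-++ as) (+-comm (length as) 1))
           (trans (++-assoc as _ _) split)
  ... | true , run , correct | _ = true ,
    ⇓weaken (cost-found (pass n) bound (length rs * (20 + pass n + bound)))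
      (⇓case-cons ⇓var (⇓case-cons (⇓start as u rs split run) ⇓yes)) ,
    mk⇔ (λ _ → u , here refl , to correct _) (λ _ → _)
  ... | false , run , correct | answer , run′ , correct′ = answer ,
    ⇓weaken (cost-root (pass n) bound (length rs * (20 + pass n + bound)))
      (⇓case-cons ⇓var (⇓case-nil (⇓start as u rs split run)
        (⇓call (⇓var ⇓∷ ⇓var ⇓∷ ⇓cons ⇓nil ⇓var ⇓∷ ⇓var ⇓∷ ⇓[]) run′))) ,
    mk⇔ (λ t → let r , r∈ , g = to correct′ t in r , there r∈ , g)
        (λ { (_ , here refl , g) → contradiction (from correct g) λ ()
           ; (r , there r∈ , g) → from correct′ (r , r∈ , g) })

  main-correct :
    Σ[ answer ∈ Bool ]
      (rows (allFin n) ∷ encodeℕ (suc d) ∷ [] ⊢ Program.main program ⇓ encodeBool answer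
        within running-time n d)
      × (T answer ⇔ ∃ λ r → G.Good r (suc d) [] [])
  main-correct with answer , run , correct ← roots-correct [] (allFin n) 0 refl refl = answer ,
    ⇓weaken (+-monoʳ-≤ 11 (+-monoˡ-≤ 3 (*-monoˡ-≤ (20 + pass n + bound) (≤-reflexive length-allFin))))
      (⇓case-cons ⇓var (⇓call (⇓var ⇓∷ ⇓var ⇓∷ ⇓cons ⇓yes ⇓nil ⇓∷ ⇓var ⇓∷ ⇓[]) run)) ,
    mk⇔ (λ t → let r , _ , g = to correct t in r , g) (λ (r , g) → from correct (r , ∈-allFin r , g))

-- Cardinalities of subsets

elements : ∀ {n} → Subset n → List (Fin n)
elements []            = []
elements (inside  ∷ p) = zero ∷ map suc (elements p)
elements (outside ∷ p) = map suc (elements p)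

length-elements : ∀ {n} (p : Subset n) → length (elements p) ≡ ∣ p ∣
length-elements []            = refl
length-elements (inside  ∷ p) = cong suc (trans (length-map suc (elements p)) (length-elements p))
length-elements (outside ∷ p) = trans (length-map suc (elements p)) (length-elements p)

elements-unique : ∀ {n} (p : Subset n) → Unique (elements p)
elements-unique []            = []
elements-unique (inside  ∷ p) =
  All.map⁺ (All.tabulate λ _ ()) ∷ Unique.map⁺ suc-injective (elements-unique p)
elements-unique (outside ∷ p) = Unique.map⁺ suc-injective (elements-unique p)

∈-elements⁺ : ∀ {n} {p : Subset n} {x} → x Subset.∈ p → x ∈ elements p
∈-elements⁺ Vec.here                      = here refl
∈-elements⁺ {p = inside  ∷ p} (Vec.there x∈) = there (∈-map⁺ suc (∈-elements⁺ x∈))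
∈-elements⁺ {p = outside ∷ p} (Vec.there x∈) = ∈-map⁺ suc (∈-elements⁺ x∈)

∈-elements⁻ : ∀ {n} (p : Subset n) {x} → x ∈ elements p → x Subset.∈ p
∈-elements⁻ (inside  ∷ p) (here refl) = Vec.here
∈-elements⁻ (inside  ∷ p) (there x∈) with y , y∈ , refl ← ∈-map⁻ suc x∈ = Vec.there (∈-elements⁻ p y∈)
∈-elements⁻ (outside ∷ p) x∈ with y , y∈ , refl ← ∈-map⁻ suc x∈ = Vec.there (∈-elements⁻ p y∈)

AtLeast⇒≤∣∣ : ∀ {n k} {p : Subset n} → AtLeast k (Subset._∈ p) → k ≤ ∣ p ∣
AtLeast⇒≤∣∣ {p = p} (L , u , k≤ , L⊆) =
  ≤-trans k≤ (≤-trans (Unique⇒length≤ u (∈-elements⁺ ∘ L⊆)) (≤-reflexive (length-elements p)))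

≤∣∣⇒AtLeast : ∀ {n k} {p : Subset n} → k ≤ ∣ p ∣ → AtLeast k (Subset._∈ p)
≤∣∣⇒AtLeast {p = p} k≤ =
  elements p , elements-unique p , ≤-trans k≤ (≤-reflexive (sym (length-elements p))) , ∈-elements⁻ p

module _ {n} (f : Fin n → Bool) where

  ∈-tabulate⇒ : ∀ {x} → x Subset.∈ Vec.tabulate f → T (f x)
  ∈-tabulate⇒ {x} x∈ = from T-≡ (trans (sym (lookup∘tabulate f x)) ([]=⇒lookup x∈))

  ⇒∈-tabulate : ∀ {x} → T (f x) → x Subset.∈ Vec.tabulate f
  ⇒∈-tabulate {x} fx = lookup⇒[]= x (Vec.tabulate f) (trans (lookup∘tabulate f x) (to T-≡ fx))

  none⇒∣∣≡0 : (∀ x → ¬ T (f x)) → ∣ Vec.tabulate f ∣ ≡ 0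
  none⇒∣∣≡0 none =
    trans (cong ∣_∣ (Subset.Empty-unique λ (x , x∈) → none x (∈-tabulate⇒ x∈))) (Subset.∣⊥∣≡0 n)

  ∣∣≡0⇒none : ∣ Vec.tabulate f ∣ ≡ 0 → ∀ x → ¬ T (f x)
  ∣∣≡0⇒none eq x fx = 1+n≰n
    (≤-trans (AtLeast⇒≤∣∣ (x ∷ [] , [] ∷ [] , ≤-refl , λ { (here refl) → ⇒∈-tabulate fx }))
             (≤-reflexive eq))

-- Simple walks and parent forests

module _ {A : Set} {R : A → A → Set} where

  start∈ : ∀ {x y} (w : Star R x y) → x ∈ vertices w
  start∈ ε       = here refl
  start∈ (_ ◅ _) = here refl

  end∈ : ∀ {x y} (w : Star R x y) → y ∈ vertices w
  end∈ ε       = here refl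
  end∈ (_ ◅ w) = there (end∈ w)

  suffix : ∀ {x y z} (w : Star R x y) → Unique (vertices w) → z ∈ vertices w → Path R z y
  suffix ε       u       (here refl) = record { walk = ε ; simple = u }
  suffix (e ◅ w) u       (here refl) = record { walk = e ◅ w ; simple = u }
  suffix (_ ◅ w) (_ ∷ u) (there z∈)  = suffix w u z∈

  prefix : ∀ {x y z} (w : Star R x y) → Unique (vertices w) → z ∈ vertices w →
           Σ[ p ∈ Path R x z ] vertices (Path.walk p) ⊆ vertices w
  prefix ε       u       (here refl) = record { walk = ε ; simple = u } , id
  prefix (e ◅ w) u       (here refl) =
    record { walk = ε ; simple = [] ∷ [] } , λ { (here refl) → here refl }
  prefix (e ◅ w) (x∉ ∷ u) (there z∈) with p , sub ← prefix w u z∈ =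
    record { walk = e ◅ Path.walk p
           ; simple = All.tabulate (λ y∈ → All.lookup x∉ (sub y∈)) ∷ Path.simple p } ,
    λ { (here refl) → here refl ; (there y∈) → there (sub y∈) }

  module _ (_≟′_ : DecidableEquality A) where
    open import Data.List.Membership.DecPropositional _≟′_ using (_∈?_)

    walk⇒path : ∀ {x y} → Star R x y → Path R x y
    walk⇒path ε = record { walk = ε ; simple = [] ∷ [] }
    walk⇒path {x} (e ◅ w) with walk⇒path w
    ... | p with x ∈? vertices (Path.walk p)
    ...   | yes x∈ = suffix (Path.walk p) (Path.simple p) x∈
    ...   | no  x∉ = record { walk = e ◅ Path.walk p
                            ; simple = All.¬Any⇒All¬ _ x∉ ∷ Path.simple p }

module Parents {n : ℕ} (r : Fin n) (parent : Fin n → Fin n) (rank : Fin n → ℕ)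
               (rank-parent : ∀ {x} → x ≢ r → rank (parent x) < rank x) where

  _isParentOf_ : Fin n → Fin n → Set
  x isParentOf y = y ≢ r × parent y ≡ x

  -- A simple walk cannot go up to a parent after a step down, since it would retrace that step.
  module Acyclic (Edge : Fin n → Fin n → Set)
                 (edge⁻ : ∀ {x y} → Edge x y → x isParentOf y ⊎ y isParentOf x) where

    descend : ∀ {x y} (w : Star Edge x y) → Unique (vertices w) → x ≢ r → parent x ∉ vertices w →
              y ≢ r × rank x ≤ rank y × (x ≡ y ⊎ parent y ∈ vertices w)
    descend ε _ x≢r _ = x≢r , ≤-refl , inj₁ refl
    descend (e ◅ w) (x∉ ∷ u) x≢r px∉ with edge⁻ e
    ... | inj₂ (_ , refl) = contradiction (there (start∈ w)) px∉
    ... | inj₁ (z≢r , refl) with descend w u z≢r (All.All¬⇒¬Any x∉)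
    ...   | y≢r , le , inj₁ refl = y≢r , ≤-trans (<⇒≤ (rank-parent z≢r)) le , inj₂ (here refl)
    ...   | y≢r , le , inj₂ py∈  = y≢r , ≤-trans (<⇒≤ (rank-parent z≢r)) le , inj₂ (there py∈)

    ascend : ∀ {x y} (w : Star Edge x y) → Unique (vertices w) →
             rank y ≤ rank x ⊎ parent y ∈ vertices w
    ascend ε _ = inj₁ ≤-refl
    ascend (e ◅ w) (x∉ ∷ u) with edge⁻ e
    ... | inj₂ (x≢r , refl) =
      [ (λ le → inj₁ (≤-trans le (<⇒≤ (rank-parent x≢r)))) , inj₂ ∘ there ]′ (ascend w u)
    ... | inj₁ (z≢r , refl) with descend w u z≢r (All.All¬⇒¬Any x∉)
    ...   | _ , _ , inj₁ refl = inj₂ (here refl)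
    ...   | _ , _ , inj₂ py∈  = inj₂ (there py∈)

    -- Cases on the first and the closing edge. If one goes up to the parent of the start and the
    -- other comes from a child, ranks contradict each other or the start recurs; two children of
    -- the start would make the start recur or the ends of the rest coincide; two parents of the
    -- start coincide.
    acyclic : ¬ Cycle Edge
    acyclic record { path = record { walk = ε } ; long = s≤s () }
    acyclic record { path = record { walk = _ ◅ ε } ; long = s≤s (s≤s ()) }
    acyclic record { path = record { walk = e ◅ w@(_ ◅ w′) ; simple = x∉ ∷ u@(z∉ ∷ _) } ; closing = c }
      with edge⁻ e | edge⁻ c
    ... | inj₁ (z≢r , refl) | inj₁ (x≢r , refl) =
      <-irrefl refl (<-≤-trans (<-trans (rank-parent x≢r) (rank-parent z≢r))
        (proj₁ (proj₂ (descend w u z≢r (All.All¬⇒¬Any x∉)))))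
    ... | inj₁ (z≢r , refl) | inj₂ (y≢r , py≡x) with descend w u z≢r (All.All¬⇒¬Any x∉)
    ...   | _ , _ , inj₁ refl = All.All¬⇒¬Any z∉ (end∈ w′)
    ...   | _ , _ , inj₂ py∈  = All.All¬⇒¬Any x∉ (subst (_∈ vertices w) py≡x py∈)
    acyclic record { path = record { walk = e ◅ w@(_ ◅ w′) ; simple = x∉ ∷ u@(z∉ ∷ _) } ; closing = c }
        | inj₂ (x≢r , refl) | inj₁ (_ , refl) = All.All¬⇒¬Any z∉ (end∈ w′)
    acyclic record { path = record { walk = e ◅ w@(_ ◅ w′) ; simple = x∉ ∷ u@(z∉ ∷ _) } ; closing = c }
        | inj₂ (x≢r , refl) | inj₂ (y≢r , py≡x) with ascend w u
    ...   | inj₁ le  = <-irrefl refl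
      (<-trans (subst (λ z → rank z < _) py≡x (rank-parent y≢r)) (≤-<-trans le (rank-parent x≢r)))
    ...   | inj₂ py∈ = All.All¬⇒¬Any x∉ (subst (_∈ vertices w) py≡x py∈)

-- Out-branchings and sets of inner vertices

module Saturation {n : ℕ} (arc : Fin n → Fin n → Bool) (r : Fin n) (k : ℕ) where

  open Growth arc r
  open import Data.List.Membership.DecPropositional (_≟_ {n}) using (_∈?_)

  record Extension (S : List (Fin n)) (Q : List (Fin n) → Set) : Set where
    constructor extension
    field
      {inner}   : List (Fin n)
      extends   : S ⊆ inner
      connected : Connected inner
      boundary  : AtLeast k (Boundary inner)
      property  : Q inner

  -- If q is not yet covered, p is a leaf; make it inner, and q replaces it as a leaf.
  cover-head : ∀ {S p q} → Connected S → AtLeast k (Boundary S) → T (covered S p) → T (arc p q) →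
               Extension S λ S′ → T (covered S′ q)
  cover-head {S} {p} {q} conn bd cp a with T? (covered S q) | p ∈? S
  ... | yes cq | _      = extension id conn bd cq
  ... | no ¬cq | yes p∈ = contradiction (covered-arc {S = S} p∈ a) ¬cq
  ... | no ¬cq | no p∉  =
    extension there (Connected-∷ conn cp) bd′ (covered-arc {S = p ∷ S} (here refl) a)
    where
    q∉ : q ∉ p ∷ S
    q∉ (here refl) = ¬cq cp
    q∉ (there q∈)  = ¬cq (Conn-covered {S = S} (conn q∈))

    bd′ = AtLeast-exchange p q (¬cq ∘ proj₁) (covered-arc {S = p ∷ S} (here refl) a , q∉)
      (λ (c , x∉) x≢p →
        covered-mono {S} there c , λ { (here refl) → x≢p refl ; (there x∈) → x∉ x∈ }) bd

  cover-end : ∀ {S p q} → Connected S → AtLeast k (Boundary S) → T (covered S p) →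
              Star (λ x y → T (arc x y)) p q → Extension S λ S′ → T (covered S′ q)
  cover-end conn bd c ε = extension id conn bd c
  cover-end conn bd c (a ◅ w) with extension sub conn′ bd′ c′ ← cover-head conn bd c a
    with extension sub″ conn″ bd″ c″ ← cover-end conn′ bd′ c′ w =
    extension (sub″ ∘ sub) conn″ bd″ c″

  saturate : ∀ {S} → (∀ x → Star (λ x y → T (arc x y)) r x) → Connected S → AtLeast k (Boundary S) →
             ∀ ys → Extension S λ S′ → ∀ {y} → y ∈ ys → T (covered S′ y)
  saturate reach conn bd [] = extension id conn bd λ ()
  saturate {S} reach conn bd (y ∷ ys)
    with extension {S₁} sub conn′ bd′ c ← cover-end conn bd (covered-root S) (reach y)
    with extension sub″ conn″ bd″ cs ← saturate reach conn′ bd′ ys =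
    extension (sub″ ∘ sub) conn″ bd″ λ { (here refl) → covered-mono {S₁} sub″ c ; (there z∈) → cs z∈ }

  module _ (S : List (Fin n)) where

    IsParent : List (Fin n) → (Fin n → ℕ) → Fin n → Fin n → Set
    IsParent P rank p x = p ∈ S × p ∈ P × T (arc p x) × rank p < rank x

    -- A partial tree on `P`, in which only vertices of `S` have children; the values of `parent`
    -- and `rank` outside `P` are irrelevant until a vertex is attached.
    record Forest (P : List (Fin n)) : Set where
      field
        parent  : Fin n → Fin n
        rank    : Fin n → ℕ
        root∈   : r ∈ P
        parents : ∀ {x} → x ∈ P → x ≢ r → IsParent P rank (parent x) x

    open Forest

    trivial : Forest (r ∷ [])
    trivial = record
      { parent = id ; rank = λ _ → 0 ; root∈ = here refl
      ; parents = λ { (here refl) r≢r → contradiction refl r≢r } }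

    attach : ∀ {P p x} → Forest P → p ∈ P → p ∈ S → T (arc p x) → x ∉ P → Forest (x ∷ P)
    attach {P} {p} {x} F p∈P p∈S a x∉ = record
      { parent = parent′ ; rank = rank′ ; root∈ = there (root∈ F) ; parents = parents′ }
      where
      parent′ : Fin n → Fin n
      parent′ y with y ≟ x
      ... | yes _ = p
      ... | no  _ = parent F y

      rank′ : Fin n → ℕ
      rank′ y with y ≟ x
      ... | yes _ = suc (rank F p)
      ... | no  _ = rank F y

      rank-old : ∀ {y} → y ∈ P → rank′ y ≡ rank F y
      rank-old {y} y∈ with y ≟ x
      ... | yes refl = contradiction y∈ x∉
      ... | no  _    = refl

      rank-new : rank′ x ≡ suc (rank F p)
      rank-new with x ≟ x
      ... | yes _   = refl
      ... | no  x≢x = contradiction refl x≢x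

      parent-old : ∀ {y} → y ∈ P → parent′ y ≡ parent F y
      parent-old {y} y∈ with y ≟ x
      ... | yes refl = contradiction y∈ x∉
      ... | no  _    = refl

      parent-new : parent′ x ≡ p
      parent-new with x ≟ x
      ... | yes _   = refl
      ... | no  x≢x = contradiction refl x≢x

      parents′ : ∀ {y} → y ∈ x ∷ P → y ≢ r → IsParent (x ∷ P) rank′ (parent′ y) y
      parents′ (here refl) _ = subst (λ q → IsParent (x ∷ P) rank′ q x) (sym parent-new)
        (p∈S , there p∈P , a , subst₂ _<_ (sym (rank-old p∈P)) (sym rank-new) (n<1+n (rank F p)))
      parents′ {y} (there y∈) y≢r with q∈S , q∈P , b , lt ← parents F y∈ y≢r =
        subst (λ q → IsParent (x ∷ P) rank′ q y) (sym (parent-old y∈))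
          (q∈S , there q∈P , b , subst₂ _<_ (sym (rank-old q∈P)) (sym (rank-old y∈)) lt)

    Containing : List (Fin n) → Fin n → Set
    Containing P x = ∃ λ P′ → Forest P′ × P ⊆ P′ × x ∈ P′

    attach-arc : ∀ {P p x} → Forest P → p ∈ P → p ∈ S → T (arc p x) → Containing P x
    attach-arc {P} {p} {x} F p∈P p∈S a with x ∈? P
    ... | yes x∈ = P , F , id , x∈
    ... | no  x∉ = x ∷ P , attach F p∈P p∈S a x∉ , there , here refl

    attach-conn : ∀ {P x} → Forest P → Conn S x → Containing P x
    attach-conn F (root _) = _ , F , id , root∈ F
    attach-conn F (step c a _) with P₁ , F₁ , sub₁ , p∈ ← attach-conn F c
      with P₂ , F₂ , sub₂ , x∈ ← attach-arc F₁ p∈ (Conn-∈ c) a = P₂ , F₂ , sub₂ ∘ sub₁ , x∈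

    attach-covered : ∀ {P x} → Connected S → Forest P → T (covered S x) → Containing P x
    attach-covered conn F c with covered⁻ S c
    ... | inj₁ refl = _ , F , id , root∈ F
    ... | inj₂ (s , s∈ , a) with P₁ , F₁ , sub₁ , s∈P ← attach-conn F (conn s∈)
      with P₂ , F₂ , sub₂ , x∈ ← attach-arc F₁ s∈P s∈ a = P₂ , F₂ , sub₂ ∘ sub₁ , x∈

    forest : Connected S → ∀ ys → (∀ {y} → y ∈ ys → T (covered S y)) → ∃ λ P → Forest P × ys ⊆ P
    forest conn [] _ = _ , trivial , λ ()
    forest conn (y ∷ ys) c with P₁ , F₁ , sub₁ ← forest conn ys (c ∘ there)
      with P₂ , F₂ , sub₂ , y∈ ← attach-covered conn F₁ (c (here refl)) =
      P₂ , F₂ , λ { (here refl) → y∈ ; (there z∈) → sub₂ (sub₁ z∈) }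

-- Translation to and from out-branchings

module _ {D : Digraph} where

  open Digraph D using () renaming (arc to arcD; Arc to ArcD)

  private
    n = order D

  module FromParents (r : Fin n) (S : List (Fin n)) (parent : Fin n → Fin n) (rank : Fin n → ℕ)
                     (parent∈ : ∀ {x} → x ≢ r → parent x ∈ S)
                     (parent-arc : ∀ {x} → x ≢ r → ArcD (parent x) x)
                     (rank-parent : ∀ {x} → x ≢ r → rank (parent x) < rank x) where

    open Parents r parent rank rank-parent

    isParentOf? : ∀ x y → Dec (x isParentOf y)
    isParentOf? x y = ¬? (y ≟ r) ×-dec (parent y ≟ x)

    branching : Subdigraph D
    branching = record
      { V      = ⊤
      ; arc    = λ x y → ⌊ isParentOf? x y ⌋
      ; arc⊆   = λ {x} {y} a → let y≢r , py≡x = toWitness {a? = isParentOf? x y} a in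
                   subst (λ z → ArcD z y) py≡x (parent-arc y≢r)
      ; tail∈V = λ _ → Subset.∈⊤
      ; head∈V = λ _ → Subset.∈⊤
      }

    open Subdigraph branching

    arc⁻ : ∀ {x y} → Arc x y → x isParentOf y
    arc⁻ {x} {y} = toWitness {a? = isParentOf? x y}

    parent-Arc : ∀ {x} → x ≢ r → Arc (parent x) x
    parent-Arc {x} x≢r = fromWitness {a? = isParentOf? (parent x) x} (x≢r , refl)

    to-root : ∀ x → Acc _<_ (rank x) → Star Edge x r
    to-root x (acc rec) with x ≟ r
    ... | yes refl = ε
    ... | no  x≢r  = inj₂ (parent-Arc x≢r) ◅ to-root (parent x) (rec (rank-parent x≢r))

    isOutBranching : IsOutBranching branching
    isOutBranching = record
      { isOutTree = record
        { isOrientedTree = record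
          { oriented  = λ a b → let y≢r , py≡x = arc⁻ a ; x≢r , px≡y = arc⁻ b in
              <-asym (subst (λ z → rank z < _) py≡x (rank-parent y≢r))
                     (subst (λ z → rank z < _) px≡y (rank-parent x≢r))
          ; connected = λ {x} {y} _ _ → walk⇒path _≟_
              (to-root x (<-wellFounded _) ◅◅ Star.reverse swap (to-root y (<-wellFounded _)))
          ; acyclic   = Acyclic.acyclic Edge λ { (inj₁ a) → inj₁ (arc⁻ a) ; (inj₂ a) → inj₂ (arc⁻ a) }
          }
        ; uniqueRoot = r , (Subset.∈⊤ , none⇒∣∣≡0 _ (λ x a → proj₁ (arc⁻ {x} a) refl)) , unique
        }
      ; spanning = λ _ → Subset.∈⊤
      }
      where
      unique : ∀ {y} → y Subset.∈ V × inDegree y ≡ 0 → r ≡ y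
      unique {y} (_ , deg≡0) = sym (decidable-stable (y ≟ r) λ y≢r →
        ∣∣≡0⇒none (λ x → arc x y) deg≡0 (parent y) (parent-Arc y≢r))

    ∉⇒leaf : ∀ {x} → x ∉ S → x Subset.∈ leaves
    ∉⇒leaf {x} x∉ = ⇒∈-tabulate _ (from T-∧ (from T-≡ (lookup-replicate x true) ,
      ≡⇒≡ᵇ _ 0 (none⇒∣∣≡0 _ λ y a →
        let y≢r , py≡x = arc⁻ {x} {y} a in x∉ (subst (_∈ S) py≡x (parent∈ y≢r)))))

  -- Strong connectivity supplies the walks from `r` along which the inner set is saturated; then
  -- every vertex gets an inner parent, and the vertices outside `S` are leaves.
  Good⇒branching : ∀ {r k} → StronglyConnected D → Growth.Good arcD r k [] [] →
                   HasOutBranchingWithLeaves D k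
  Good⇒branching {r} {k} sc (Growth.good _ _ conn bd)
    with Saturation.extension {S} _ conn′ (L , uL , k≤ , bd′) c ←
           Saturation.saturate arcD r k (λ x → Path.walk (proj₁ (sc r x))) conn bd (allFin n)
    with P , F , all ← Saturation.forest arcD r k S conn′ (allFin n) c =
    branching , isOutBranching , AtLeast⇒≤∣∣ (L , uL , k≤ , λ x∈ → ∉⇒leaf (proj₂ (bd′ x∈)))
    where
    par = λ {x} → Saturation.Forest.parents F (all (∈-allFin x))
    open FromParents r S (Saturation.Forest.parent F) (Saturation.Forest.rank F)
      (λ x≢r → proj₁ (par x≢r))
      (λ x≢r → proj₁ (proj₂ (proj₂ (par x≢r))))
      (λ x≢r → proj₂ (proj₂ (proj₂ (par x≢r))))

  module FromBranching (B : Subdigraph D) (isB : IsOutBranching B) where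

    open Subdigraph B
    open IsOutBranching isB
    open IsOutTree isOutTree
    open IsOrientedTree isOrientedTree

    r : Fin n
    r = proj₁ uniqueRoot

    parent : ∀ {x} → x ≢ r → ∃ λ p → Arc p x
    parent {x} x≢r with Subset.nonempty? (Vec.tabulate λ p → arc p x)
    ... | yes (p , p∈) = p , ∈-tabulate⇒ _ p∈
    ... | no  empty    = contradiction
      (sym (proj₂ (proj₂ uniqueRoot)
        (spanning x , none⇒∣∣≡0 _ λ p a → empty (p , ⇒∈-tabulate _ a)))) x≢r

    edges : ∀ {x y} → Star Arc x y → Star Edge x y
    edges = Star.map inj₁

    vertices-edges : ∀ {x y} (w : Star Arc x y) → vertices (edges w) ≡ vertices w
    vertices-edges ε       = refl
    vertices-edges (_ ◅ w) = cong (_ ∷_) (vertices-edges w)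

    -- A directed cycle of length 1 is a loop, one of length 2 violates the orientation, and a
    -- longer one is a cycle of the underlying tree.
    no-cycle : ∀ {x y} (p : Path Arc x y) → ¬ Arc y x
    no-cycle record { walk = ε } a = Digraph.loopless D _ (arc⊆ a)
    no-cycle record { walk = b ◅ ε } a = oriented a b
    no-cycle record { walk = w@(_ ◅ _ ◅ w′) ; simple = u } a = acyclic record
      { path    = record { walk = edges w ; simple = subst Unique (sym (vertices-edges w)) u }
      ; long    = s≤s (s≤s (len (edges w′)))
      ; closing = inj₁ a
      }
      where
      len : ∀ {x y} (w : Star Edge x y) → 1 ≤ length (vertices w)
      len ε       = s≤s z≤n
      len (_ ◅ _) = s≤s z≤n

    open import Data.List.Membership.DecPropositional (_≟_ {n}) using (_∈?_)

    -- Follow parents; a repeated vertex would close a cycle, so at most n steps are needed.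
    climb : ∀ f {x y} (p : Path Arc x y) → n ≤ f + length (vertices (Path.walk p)) → Star Arc r y
    climb f {x} p le with x ≟ r
    ... | yes refl = Path.walk p
    ... | no  x≢r with q , a ← parent x≢r with q ∈? vertices (Path.walk p)
    ...   | yes q∈ = contradiction a (no-cycle (proj₁ (prefix (Path.walk p) (Path.simple p) q∈)))
    ...   | no  q∉ = continue f le
      where
      p′ : Path Arc q _
      p′ = record { walk = a ◅ Path.walk p ; simple = All.¬Any⇒All¬ _ q∉ ∷ Path.simple p }

      continue : ∀ f → n ≤ f + length (vertices (Path.walk p)) → Star Arc r _
      continue zero    le = contradiction (≤-trans (Unique⇒length≤n (Path.simple p′)) le) 1+n≰n
      continue (suc f) le = climb f p′ (≤-trans le (≤-reflexive (sym (+-suc f _))))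

    from-root : ∀ x → Star Arc r x
    from-root x = climb n (record { walk = ε ; simple = [] ∷ [] }) (m≤m+n n 1)

    hasChild? : ∀ x → Dec (Subset.Nonempty (Vec.tabulate (arc x)))
    hasChild? x = Subset.nonempty? (Vec.tabulate (arc x))

    inner : List (Fin n)
    inner = filter hasChild? (allFin n)

    tail∈inner : ∀ {x y} → Arc x y → x ∈ inner
    tail∈inner {x} {y} a = ∈-filter⁺ hasChild? (∈-allFin x) (y , ⇒∈-tabulate _ a)

    open Growth arcD r

    -- Every vertex of a directed walk except the last has a child, hence is inner.
    connect : ∀ {x y} → Conn inner x → Star Arc x y → y ∈ inner → Conn inner y
    connect c ε                 _  = c
    connect c (a ◅ ε)           y∈ = step c (arc⊆ a) y∈
    connect c (a ◅ w@(b ◅ _)) y∈ = connect (step c (arc⊆ a) (tail∈inner b)) w y∈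

    connected-inner : Connected inner
    connected-inner {x} x∈ = go (from-root x) x∈
      where
      go : ∀ {x} → Star Arc r x → x ∈ inner → Conn inner x
      go ε         x∈ = root x∈
      go w@(a ◅ _) x∈ = connect (root (tail∈inner a)) w x∈

    all-covered : ∀ x → T (covered inner x)
    all-covered x with x ≟ r
    ... | yes refl = covered-root inner
    ... | no  x≢r  = let _ , a = parent x≢r in covered-arc (tail∈inner a) (arc⊆ a)

    leaf⇒∉inner : ∀ {x} → x Subset.∈ leaves → x ∉ inner
    leaf⇒∉inner {x} x∈ x∈inner =
      let y , y∈ = proj₂ (∈-filter⁻ hasChild? {xs = allFin n} x∈inner) in
      ∣∣≡0⇒none (arc x) (≡ᵇ⇒≡ _ 0 (proj₂ (to (T-∧ {lookup V x}) (∈-tabulate⇒ _ x∈)))) y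
        (∈-tabulate⇒ _ y∈)

    leaves⇒Good : ∀ {k} → k ≤ ∣ leaves ∣ → Good k [] []
    leaves⇒Good k≤ with L , u , k≤L , L⊆ ← ≤∣∣⇒AtLeast k≤ =
      good (λ ()) (λ ()) connected-inner (L , u , k≤L , λ x∈ → all-covered _ , leaf⇒∉inner (L⊆ x∈))

  branching⇒Good : ∀ {k} → HasOutBranchingWithLeaves D k → ∃ λ r → Growth.Good arcD r k [] []
  branching⇒Good (B , isB , k≤) = FromBranching.r B isB , FromBranching.leaves⇒Good B isB k≤

-- The running time

encodeDigraph-rows : ∀ D → encodeDigraph D ≡ Rows.rows (Digraph.arc D) (allFin (order D))
encodeDigraph-rows D = cong encodeList (begin
  tabulate (λ x → encodeList (tabulate λ y → encodeBool (arc x y)))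
    ≡⟨ tabulate-cong (λ x → cong encodeList (encode-row x)) ⟩
  tabulate (Rows.row arc)
    ≡⟨ sym (map-tabulate id (Rows.row arc)) ⟩
  map (Rows.row arc) (allFin (order D))
    ∎)
  where
  open ≡-Reasoning
  open Digraph D using (arc)

  encode-row : ∀ x → tabulate (λ y → encodeBool (arc x y)) ≡
                     map encodeBool (map (arc x) (allFin (order D)))
  encode-row x = trans (sym (map-tabulate (arc x) encodeBool))
                       (cong (map encodeBool) (sym (map-tabulate id (arc x))))

overhead : ℕ → ℕ
overhead n = 20 + n * step-cost n

-- Adding `overhead n` turns the recurrence into pure doubling.
budget-bound : ∀ n m → budget n m + overhead n ≤ 2 ^ m * (overhead n + overhead n)
budget-bound n zero = ≤-trans (+-monoˡ-≤ (overhead n) (+-monoˡ-≤ (n * step-cost n) (m≤m+n 3 17)))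
  (≤-reflexive (sym (+-identityʳ _)))
budget-bound n (suc m) = begin
  overhead n + (b + b) + overhead n           ≡⟨ lemma (overhead n) b ⟩
  2 * (b + overhead n)                        ≤⟨ *-monoʳ-≤ 2 (budget-bound n m) ⟩
  2 * (2 ^ m * (overhead n + overhead n))     ≡⟨ sym (*-assoc 2 (2 ^ m) _) ⟩
  2 ^ suc m * (overhead n + overhead n)       ∎
  where
  open ≤-Reasoning
  b = budget n m
  lemma : ∀ w b → w + (b + b) + w ≡ 2 * (b + w)
  lemma = solve-∀

-- `overhead n` is `20 + 60 n + 52 n²`, and `132` is the sum of its coefficients.
overhead-bound : ∀ n′ → let n = suc n′ in overhead n ≤ 132 * (n * n)
overhead-bound n′ = slack (100 * n′ + 80 * (n′ * n′)) (lemma n′)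
  where
  lemma : ∀ x → 20 + (1 + x) * (40 + 4 * ((1 + x) * 13 + 5)) + (100 * x + 80 * (x * x)) ≡
                132 * ((1 + x) * (1 + x))
  lemma = solve-∀

-- Again a sum of coefficients: `316 = 14 + 25 + 13 + 264`, where `264 = 2 * 132`. Positivity of
-- `2 ^ m` absorbs the lower terms.
total-bound : ∀ n′ m → let n = suc n′ in
  11 + (n * (20 + pass n + budget n m) + 3) ≤ 316 * 2 ^ m * n ^ 3
total-bound n′ m with 2 ^ m in eq | m^n>0 2 m
... | suc p | _ = ≤-trans
  (+-monoʳ-≤ 11 (+-monoˡ-≤ 3 (*-monoʳ-≤ n (+-monoʳ-≤ (20 + pass n) b≤))))
  (slack (105 * n′ + 143 * (n′ * n′) + 52 * (n′ * n′ * n′) + 52 * (n * (n * n)) * p) (lemma n′ p))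
  where
  n = suc n′
  b≤ : budget n m ≤ suc p * (264 * (n * n))
  b≤ = begin
    budget n m                              ≤⟨ m≤m+n _ _ ⟩
    budget n m + overhead n                 ≤⟨ budget-bound n m ⟩
    2 ^ m * (overhead n + overhead n)       ≡⟨ cong (λ q → q * (overhead n + overhead n)) eq ⟩
    suc p * (overhead n + overhead n)
      ≤⟨ *-monoʳ-≤ (suc p) (+-mono-≤ (overhead-bound n′) (overhead-bound n′)) ⟩
    suc p * (132 * (n * n) + 132 * (n * n)) ≡⟨ cong (suc p *_) (sym (*-distribʳ-+ (n * n) 132 132)) ⟩
    suc p * (264 * (n * n))                 ∎
    where open ≤-Reasoning
  lemma : ∀ x p →
    11 + ((1 + x) * (20 + ((1 + x) * 13 + 5) + (1 + p) * (264 * ((1 + x) * (1 + x)))) + 3) +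
      (105 * x + 143 * (x * x) + 52 * (x * x * x) + 52 * ((1 + x) * ((1 + x) * (1 + x))) * p) ≡
    316 * (1 + p) * ((1 + x) * ((1 + x) * ((1 + x) * 1)))
  lemma = solve-∀

-- At `k = 1` the logarithm is 0 and the summand 2 carries the bound; it becomes the factor 4 in
-- `final-bound`. From `k = 2` on the logarithm is at least 1.
exponent-bound : ∀ d → 2 + 2 * d ≤ 2 + 2 * (suc d * ⌊log₂ suc d ⌋ ^ 2)
exponent-bound zero = ≤-refl
exponent-bound d@(suc d′) = +-monoʳ-≤ 2 (*-monoʳ-≤ 2 (begin
  d                            ≤⟨ n≤1+n d ⟩
  suc d                        ≡⟨ sym (*-identityʳ (suc d)) ⟩
  suc d * 1                    ≤⟨ *-monoʳ-≤ (suc d) (^-monoˡ-≤ 2 log≥1) ⟩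
  suc d * ⌊log₂ suc d ⌋ ^ 2    ∎))
  where
  open ≤-Reasoning
  log≥1 : 1 ≤ ⌊log₂ suc d ⌋
  log≥1 = ⌊log₂⌋-mono-≤ {2} {suc d} (s≤s (s≤s z≤n))

-- `1264 = 316 * 4` collects the constant factors; as exponents of `n` and of 2, values 3 and 2 of
-- `c` would do.
final-bound : ∀ n′ d c → 1264 ≤ c → let n = suc n′ in
  running-time n d ≤ c * 2 ^ (c * (suc d * ⌊log₂ suc d ⌋ ^ 2)) * n ^ c
final-bound n′ d c c≥ = begin
  running-time n d                     ≤⟨ total-bound n′ (1 + 2 * d) ⟩
  316 * 2 ^ (1 + 2 * d) * n ^ 3        ≤⟨ *-mono-≤ (*-monoʳ-≤ 316 pow≤)
                                            (^-monoʳ-≤ n (≤-trans (m≤m+n 3 1261) c≥)) ⟩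
  316 * (4 * 2 ^ (c * e)) * n ^ c      ≡⟨ cong (_* n ^ c) (sym (*-assoc 316 4 (2 ^ (c * e)))) ⟩
  1264 * 2 ^ (c * e) * n ^ c           ≤⟨ *-monoˡ-≤ (n ^ c) (*-monoˡ-≤ (2 ^ (c * e)) c≥) ⟩
  c * 2 ^ (c * e) * n ^ c              ∎
  where
  open ≤-Reasoning
  n = suc n′
  e = suc d * ⌊log₂ suc d ⌋ ^ 2
  pow≤ : 2 ^ (1 + 2 * d) ≤ 4 * 2 ^ (c * e)
  pow≤ = begin
    2 ^ (1 + 2 * d)    ≤⟨ ^-monoʳ-≤ 2 (≤-trans (n≤1+n _) (exponent-bound d)) ⟩
    2 ^ (2 + 2 * e)    ≡⟨ ^-distribˡ-+-* 2 2 (2 * e) ⟩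
    4 * 2 ^ (2 * e)    ≤⟨ *-monoʳ-≤ 4 (^-monoʳ-≤ 2 (*-monoˡ-≤ e (≤-trans (m≤m+n 2 1262) c≥))) ⟩
    4 * 2 ^ (c * e)    ∎

open _⊢_⇓_within_

decide : ∀ c → 1264 ≤ c → (D : Digraph) → StronglyConnected D → (k : ℕ) → k ≥ 1 →
  Σ[ answer ∈ Bool ] Σ[ t ∈ ℕ ]
    (Run program (encodeDigraph D ∷ encodeℕ k ∷ []) (encodeBool answer) t
     × (T answer ⇔ HasOutBranchingWithLeaves D k)
     × t ≤ c * 2 ^ (c * (k * ⌊log₂ k ⌋ ^ 2)) * order D ^ c)
decide c c≥ record { order = zero ; nonEmpty = () }
decide c c≥ D@record { order = suc n′ ; arc = arc } sc (suc d) _ =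
  let answer , run , correct = Roots.main-correct arc d
  in answer , cost run ,
     subst (λ w → Run program (w ∷ encodeℕ (suc d) ∷ []) (encodeBool answer) (cost run))
       (sym (encodeDigraph-rows D)) (eval run) ,
     mk⇔ (λ yes → Good⇒branching sc (proj₂ (to correct yes))) (from correct ∘ branching⇒Good) ,
     ≤-trans (bounded run) (final-bound n′ d c c≥)

-- Opaque, because unfolding the literal in the bound makes type checking infeasible.
opaque
  constant : ℕ
  constant = 1264

  constant-large : 1264 ≤ constant
  constant-large = ≤-refl

corollary2 : Σ[ P ∈ Program 2 ] Σ[ c ∈ ℕ ]
    ((D : Digraph) → StronglyConnected D → (k : ℕ) → k ≥ 1 →
    Σ[ answer ∈ Bool ] Σ[ t ∈ ℕ ]
    (Run P (encodeDigraph D ∷ encodeℕ k ∷ []) (encodeBool answer) t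
    × (T answer ⇔ HasOutBranchingWithLeaves D k)
    × t ≤ c * 2 ^ (c * (k * ⌊log₂ k ⌋ ^ 2)) * order D ^ c))
corollary2 = program , constant , decide constant constant-large
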